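{- Consider the online graph partitioning problem with $\ell$ servers and server capacity $k$, where the online algorithm may place up to $(1+\varepsilon)k$ vertices on each server, and suppose $\varepsilon>1$ is a fixed constant. Then there exists a deterministic online algorithm with competitive ratio $O(\log k)$.
   Context: Online graph partitioning problem: There is a vertex set $V$ with $|V|=\ell\cdot k$. Initially each vertex is assigned to one of $\ell$ servers so that every server holds exactly $k$ vertices, and the graph $G=(V,E)$ has $E=\emptyset$. Edges of $G$ are then revealed one by one in an online fashion. The request sequence is guaranteed to be such that at all times there exists an assignment of vertices to servers in which each server holds at most $k$ vertices and every connected component of the current graph lies entirely on one server. After each edge insertion, an online algorithm must (possibly) move vertices between servers so that every connected component of the revealed graph lies entirely on a single server (cc-condition), while each server holds at most $(1+\varepsilon)k$ vertices. Each vertex move costs $1/k$. The optimal offline algorithm $\mathrm{OPT}$ knows the whole sequence in advance and must keep at most $k$ vertices per server; its cost is the minimum total cost of moves needed. The (strict) competitive ratio of an online algorithm $\mathrm{ONL}$ is the supremum over request sequences of $\mathrm{cost}(\mathrm{ONL})/\mathrm{cost}(\mathrm{OPT})$; the edge insertion order is adversarial. -}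

module Defs where

open import Data.Nat using (ℕ; zero; suc; _+_; _*_; _≤_)
open import Data.Fin using (Fin; _≟_)
open import Data.List using (List; length; filter; take; allFin)
open import Data.List.Membership.Propositional using (_∈_)
open import Data.Product using (Σ; _×_; _,_)
open import Relation.Binary.PropositionalEquality using (_≡_)
open import Relation.Nullary.Decidable using (¬?)

Edge : ℕ → Set
Edge n = Fin n × Fin n

data Connected {n : ℕ} (E : List (Edge n)) : Fin n → Fin n → Set where
  here : ∀ {u} → Connected E u u
  fwd  : ∀ {u v w} → (u , v) ∈ E → Connected E v w → Connected E u w
  bwd  : ∀ {u v w} → (v , u) ∈ E → Connected E v w → Connected E u w

Assignment : ℕ → ℕ → Set
Assignment n ℓ = Fin n → Fin ℓ

load : ∀ {n ℓ} → Assignment n ℓ → Fin ℓ → ℕ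
load {n} a s = length (filter (λ v → a v ≟ s) (allFin n))

CC : ∀ {n ℓ} → List (Edge n) → Assignment n ℓ → Set
CC E a = ∀ u v → Connected E u v → a u ≡ a v

LoadAtMost : ∀ {n ℓ} → ℕ → Assignment n ℓ → Set
LoadAtMost cap a = ∀ s → load a s ≤ cap

-- Every server holds at most (1 + p/q) k vertices  (ε = p/q),
-- i.e. q * load ≤ (q + p) * k.
LoadAtMostAug : ∀ {n ℓ} → (p q k : ℕ) → Assignment n ℓ → Set
LoadAtMostAug p q k a = ∀ s → q * load a s ≤ (q + p) * k

Balanced : ∀ {n ℓ} → ℕ → Assignment n ℓ → Set
Balanced k a = ∀ s → load a s ≡ k

-- Number of vertices whose server differs between two assignments
-- (= number of vertex moves needed to go from a to b; each costs 1/k).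
moves : ∀ {n ℓ} → Assignment n ℓ → Assignment n ℓ → ℕ
moves {n} a b = length (filter (λ v → ¬? (a v ≟ b v)) (allFin n))

sumTo : ℕ → (ℕ → ℕ) → ℕ
sumTo zero    f = 0
sumTo (suc T) f = sumTo T f + f T

scheduleMoves : ∀ {n ℓ} → (ℕ → Assignment n ℓ) → ℕ → ℕ
scheduleMoves b T = sumTo T (λ t → moves (b t) (b (suc t)))

ValidSeq : ∀ {n} → (ℓ k : ℕ) → List (Edge n) → Set
ValidSeq {n} ℓ k σ =
  ∀ t → t ≤ length σ →
    Σ (Assignment n ℓ) (λ b → CC (take t σ) b × LoadAtMost k b)

-- A deterministic online algorithm: given the initial assignment and the
-- edges revealed so far, it outputs the new assignment.
OnlineAlg : ℕ → ℕ → Set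
OnlineAlg n ℓ = Assignment n ℓ → List (Edge n) → Assignment n ℓ

run : ∀ {n ℓ} → OnlineAlg n ℓ → Assignment n ℓ → List (Edge n) → ℕ → Assignment n ℓ
run A init σ zero    = init
run A init σ (suc t) = A init (take (suc t) σ)

OnlineFeasible : ∀ {n ℓ} → (p q k : ℕ) → (ℕ → Assignment n ℓ) → List (Edge n) → Set
OnlineFeasible p q k a σ =
  ∀ t → 1 ≤ t → t ≤ length σ → CC (take t σ) (a t) × LoadAtMostAug p q k (a t)

OfflineFeasible : ∀ {n ℓ} → (k : ℕ) → Assignment n ℓ → List (Edge n) → (ℕ → Assignment n ℓ) → Set
OfflineFeasible k init σ b =
  (b 0 ≡ init) ×
  (∀ t → 1 ≤ t → t ≤ length σ → CC (take t σ) (b t) × LoadAtMost k (b t))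

{-# OPTIONS --safe #-}
-- Components are merged small into large. A component c sitting on a server s is sent to a server
-- r ≠ s as soon as more than 3/4 of c started on r, and a server that exceeds its capacity evicts
-- components of which it is not the majority origin, each to a server with load at most k, until
-- its load is at most 2k; the components it must keep have total size at most 2k.
--
-- An eviction is paid for by the drop of Σ_s (load s ∸ 2k): it happens only once the load exceeds
-- 2k by more than k/q, and it costs at most k more than that excess. A return to the majority
-- origin r is paid for by size c ∸ 2 #{v ∈ c : v did not start on r}, which grows only by the
-- volume of merge moves. A merge move of x into the larger y on another server is paid for by
-- min(size c, 8 min_r #{v ∈ c : v did not start on r}) · (1 + log₂ (size c)): either the
-- minimum is size c for the union, where the level of x rises by one, or the minimum itself
-- grows by size x, because x and y are not both mostly from the same server. The inner minimum,
-- summed over all components, is a lower bound on the offline cost.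
module Submission where

open import Defs
open import Data.Bool using (true; false; if_then_else_)
open import Data.Empty using (⊥-elim)
open import Data.Fin using (Fin; zero; suc; _≟_; fromℕ<)
open import Data.Fin.Properties using (any?; toℕ-fromℕ<)
open import Data.List using (List; []; _∷_; _∷ʳ_; length; filter; tabulate; foldl; allFin; take; lookup)
open import Data.List.Membership.Propositional using (_∈_)
open import Data.List.Membership.Propositional.Properties using (∈-allFin; ∈-++⁺ˡ; ∈-++⁺ʳ; ∈-++⁻)
open import Data.List.Properties using (take-suc; foldl-∷ʳ)
open import Data.List.Relation.Unary.All as All using (All; []; _∷_)
open import Data.Nat using (ℕ; zero; suc; _+_; _*_; _∸_; _≤_; _<_; _⊓_; _⊔_; z≤n; s≤s; _≤?_; _<?_; >-nonZero)
open import Data.Nat.Logarithm using (⌊log₂_⌋; ⌊log₂⌋-mono-≤; ⌊log₂[2*b]⌋≡1+⌊log₂b⌋)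
open import Data.List.Relation.Unary.Any as Any using ()
open import Data.Nat.Properties hiding (_≟_; _≤?_; _<?_)
open import Data.Nat.Tactic.RingSolver using (solve-∀)
open import Data.Product using (Σ; ∃; _×_; _,_; proj₁; proj₂)
open import Data.Sum using (_⊎_; inj₁; inj₂)
open import Function using (_∘_; id)
open import Relation.Binary.PropositionalEquality using (_≡_; _≢_; refl; sym; trans; cong; cong₂; subst; module ≡-Reasoning)
open import Relation.Nullary using (Dec; yes; no; does; ¬_)
open import Relation.Nullary.Decidable using (¬?; _×-dec_)
open import Relation.Unary using (Decidable)
open import Algebra.Properties.Semiring.Sum +-*-semiring using (sum; sum-cong-≗; ∑-distrib-+; ∑-comm; *-distribˡ-sum; *-distribʳ-sum)

-- Linear arithmetic by a ring identity: l ≤ r is a combination of the hypotheses, d the slack.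
≤-from : ∀ {x y l r} d → l ≤ r → x + r + d ≡ y + l → x ≤ y
≤-from {x} {y} {l} {r} d l≤r eq = +-cancelʳ-≤ l x y (begin
  x + l      ≤⟨ +-monoʳ-≤ x l≤r ⟩
  x + r      ≤⟨ m≤m+n (x + r) d ⟩
  x + r + d  ≡⟨ eq ⟩
  y + l      ∎)
  where open ≤-Reasoning


-- Finite sums, suprema and infima

[_]ᵢ : ∀ {a} {P : Set a} → Dec P → ℕ
[ d ]ᵢ = if does d then 1 else 0

sum-mono : ∀ {n} {f g : Fin n → ℕ} → (∀ i → f i ≤ g i) → sum f ≤ sum g
sum-mono {zero}  le = z≤n
sum-mono {suc n} le = +-mono-≤ (le zero) (sum-mono (le ∘ suc))

sum-zero : ∀ n → sum {n} (λ _ → 0) ≡ 0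
sum-zero zero    = refl
sum-zero (suc n) = sum-zero n

sum-const : ∀ n c → sum {n} (λ _ → c) ≡ n * c
sum-const zero    c = refl
sum-const (suc n) c = cong (c +_) (sum-const n c)

sum-indicator : ∀ {n} (x : Fin n) → sum (λ i → [ x ≟ i ]ᵢ) ≡ 1
sum-indicator {suc n} zero    = cong suc (sum-zero n)
sum-indicator {suc n} (suc x) = trans (sum-cong-≗ eq) (sum-indicator x)
  where
  eq : ∀ i → [ suc x ≟ suc i ]ᵢ ≡ [ x ≟ i ]ᵢ
  eq i with x ≟ i
  ... | yes _ = refl
  ... | no  _ = refl

length-filter-tabulate : ∀ {n} {A : Set} {P : A → Set} (P? : Decidable P) (f : Fin n → A) →
  length (filter P? (tabulate f)) ≡ sum (λ i → [ P? (f i) ]ᵢ)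
length-filter-tabulate {zero}  P? f = refl
length-filter-tabulate {suc n} P? f with does (P? (f zero))
... | true  = cong suc (length-filter-tabulate P? (f ∘ suc))
... | false = length-filter-tabulate P? (f ∘ suc)

-- Used when a single server or component changes: `d` is what that change releases and `e` what it
-- adds. Keeping them on opposite sides avoids truncated subtraction.
sum-≤-at₁ : ∀ {n} (f g : Fin n → ℕ) y d e →
  (∀ c → c ≢ y → f c ≤ g c) → f y + d ≤ g y + e → sum f + d ≤ sum g + e
sum-≤-at₁ {suc n} f g zero d e off at =
  ≤-from 0 (+-mono-≤ (sum-mono (λ c → off (suc c) (λ ()))) at) (eq (f zero) (sum (f ∘ suc)) (g zero) (sum (g ∘ suc)) d e)
  where
  eq : ∀ a b a′ b′ d e → a + b + d + (b′ + (a′ + e)) + 0 ≡ a′ + b′ + e + (b + (a + d))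
  eq = solve-∀
sum-≤-at₁ {suc n} f g (suc y) d e off at =
  ≤-from 0 (+-mono-≤ (off zero (λ ())) (sum-≤-at₁ (f ∘ suc) (g ∘ suc) y d e (λ c c≢y → off (suc c) λ { refl → c≢y refl }) at))
    (eq (f zero) (sum (f ∘ suc)) (g zero) (sum (g ∘ suc)) d e)
  where
  eq : ∀ a b a′ b′ d e → a + b + d + (a′ + (b′ + e)) + 0 ≡ a′ + b′ + e + (a + (b + d))
  eq = solve-∀

-- A merge shifts weight from label `x` to label `y`, so the summands at these two indices can only
-- be compared jointly.
sum-≤-at₂ : ∀ {n} (f g : Fin n → ℕ) x y d e → x ≢ y →
  (∀ c → c ≢ x → c ≢ y → f c ≤ g c) → f x + f y + d ≤ g x + g y + e → sum f + d ≤ sum g + e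
sum-≤-at₂ {suc n} f g zero zero d e x≢y off at = ⊥-elim (x≢y refl)
sum-≤-at₂ {suc n} f g zero (suc y) d e x≢y off at =
  ≤-from 0 (sum-≤-at₁ (f ∘ suc) (g ∘ suc) y (f zero + d) (g zero + e)
      (λ c c≢y → off (suc c) (λ ()) λ { refl → c≢y refl })
      (≤-from 0 at (eq′ (f zero) (f (suc y)) (g zero) (g (suc y)) d e)))
    (eq (f zero) (sum (f ∘ suc)) (g zero) (sum (g ∘ suc)) d e)
  where
  eq′ : ∀ a b a′ b′ d e → b + (a + d) + (a′ + b′ + e) + 0 ≡ b′ + (a′ + e) + (a + b + d)
  eq′ = solve-∀
  eq : ∀ a b a′ b′ d e → a + b + d + (b′ + (a′ + e)) + 0 ≡ a′ + b′ + e + (b + (a + d))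
  eq = solve-∀
sum-≤-at₂ {suc n} f g (suc x) zero d e x≢y off at =
  sum-≤-at₂ f g zero (suc x) d e (λ ()) (λ c p q → off c q p)
    (≤-from 0 at (eq (f zero) (f (suc x)) (g zero) (g (suc x)) d e))
  where
  eq : ∀ a b a′ b′ d e → a + b + d + (b′ + a′ + e) + 0 ≡ a′ + b′ + e + (b + a + d)
  eq = solve-∀
sum-≤-at₂ {suc n} f g (suc x) (suc y) d e x≢y off at =
  ≤-from 0 (+-mono-≤ (off zero (λ ()) (λ ()))
      (sum-≤-at₂ (f ∘ suc) (g ∘ suc) x y d e (λ { refl → x≢y refl })
        (λ c c≢x c≢y → off (suc c) (λ { refl → c≢x refl }) (λ { refl → c≢y refl })) at))
    (eq (f zero) (sum (f ∘ suc)) (g zero) (sum (g ∘ suc)) d e)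
  where
  eq : ∀ a b a′ b′ d e → a + b + d + (a′ + (b′ + e)) + 0 ≡ a′ + b′ + e + (a + (b + d))
  eq = solve-∀

sup : ∀ {n} → (Fin n → ℕ) → ℕ
sup {zero}  f = 0
sup {suc n} f = f zero ⊔ sup (f ∘ suc)

≤-sup : ∀ {n} (f : Fin n → ℕ) r → f r ≤ sup f
≤-sup f zero    = m≤m⊔n _ _
≤-sup f (suc r) = ≤-trans (≤-sup (f ∘ suc) r) (m≤n⊔m (f zero) _)

sup-least : ∀ {n} (f : Fin n → ℕ) {b} → (∀ r → f r ≤ b) → sup f ≤ b
sup-least {zero}  f le = z≤n
sup-least {suc n} f le = ⊔-lub (le zero) (sup-least (f ∘ suc) (le ∘ suc))

-- The bound `b` gives a value when there are no indices; in `charge` it also serves as the cap by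
-- the component size.
inf : ∀ {n} → ℕ → (Fin n → ℕ) → ℕ
inf {zero}  b f = b
inf {suc n} b f = f zero ⊓ inf b (f ∘ suc)

inf-≤-bound : ∀ {n} b (f : Fin n → ℕ) → inf b f ≤ b
inf-≤-bound {zero}  b f = ≤-refl
inf-≤-bound {suc n} b f = ≤-trans (m⊓n≤n (f zero) _) (inf-≤-bound b (f ∘ suc))

inf-≤ : ∀ {n} b (f : Fin n → ℕ) r → inf b f ≤ f r
inf-≤ b f zero    = m⊓n≤m _ _
inf-≤ b f (suc r) = ≤-trans (m⊓n≤n (f zero) _) (inf-≤ b (f ∘ suc) r)

inf-greatest : ∀ {n b m} {f : Fin n → ℕ} → m ≤ b → (∀ r → m ≤ f r) → m ≤ inf b f
inf-greatest {zero}  m≤b m≤f = m≤b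
inf-greatest {suc n} m≤b m≤f = ⊓-glb (m≤f zero) (inf-greatest m≤b (m≤f ∘ suc))

inf-attained : ∀ {n} b (f : Fin n → ℕ) → inf b f ≡ b ⊎ ∃ λ r → inf b f ≡ f r
inf-attained {zero}  b f = inj₁ refl
inf-attained {suc n} b f with ⊓-sel (f zero) (inf b (f ∘ suc))
... | inj₁ eq = inj₂ (zero , eq)
... | inj₂ eq with inf-attained b (f ∘ suc)
...   | inj₁ eq′       = inj₁ (trans eq eq′)
...   | inj₂ (r , eq′) = inj₂ (suc r , trans eq eq′)

-- Loads and moves

load-sum : ∀ {n ℓ} (a : Assignment n ℓ) s → load a s ≡ sum (λ v → [ a v ≟ s ]ᵢ)
load-sum a s = length-filter-tabulate (λ v → a v ≟ s) id

moves-sum : ∀ {n ℓ} (a b : Assignment n ℓ) → moves a b ≡ sum (λ v → [ ¬? (a v ≟ b v) ]ᵢ)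
moves-sum a b = length-filter-tabulate (λ v → ¬? (a v ≟ b v)) id

moves-≤ : ∀ {n ℓ} (a b : Assignment n ℓ) {w : Fin n → ℕ} →
  (∀ v → a v ≢ b v → 1 ≤ w v) → moves a b ≤ sum w
moves-≤ a b {w} le = ≤-trans (≤-reflexive (moves-sum a b)) (sum-mono pointwise)
  where
  pointwise : ∀ v → [ ¬? (a v ≟ b v) ]ᵢ ≤ w v
  pointwise v with a v ≟ b v
  ... | yes _ = z≤n
  ... | no ne = le v ne

moves-≗ : ∀ {n ℓ} (a b : Assignment n ℓ) → (∀ v → a v ≡ b v) → moves a b ≡ 0
moves-≗ {n} a b eq = n≤0⇒n≡0 (≤-trans (moves-≤ a b (λ v ne → ⊥-elim (ne (eq v)))) (≤-reflexive (sum-zero n)))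

moves-refl : ∀ {n ℓ} (a : Assignment n ℓ) → moves a a ≡ 0
moves-refl a = moves-≗ a a (λ _ → refl)

moves-triangle : ∀ {n ℓ} (a b c : Assignment n ℓ) → moves a c ≤ moves a b + moves b c
moves-triangle a b c rewrite moves-sum a b | moves-sum b c =
  ≤-trans (moves-≤ a c pointwise) (≤-reflexive (∑-distrib-+ (λ v → [ ¬? (a v ≟ b v) ]ᵢ) (λ v → [ ¬? (b v ≟ c v) ]ᵢ)))
  where
  pointwise : ∀ v → a v ≢ c v → 1 ≤ [ ¬? (a v ≟ b v) ]ᵢ + [ ¬? (b v ≟ c v) ]ᵢ
  pointwise v ne with a v ≟ b v | b v ≟ c v
  ... | yes p | yes q = ⊥-elim (ne (trans p q))
  ... | yes _ | no  _ = ≤-refl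
  ... | no  _ | _     = s≤s z≤n

-- Iterated triangle inequality. It reduces an offline schedule to its final assignment, which is
-- all that the analysis compares with.
moves-schedule : ∀ {n ℓ} (b : ℕ → Assignment n ℓ) T → moves (b 0) (b T) ≤ scheduleMoves b T
moves-schedule b zero    = ≤-reflexive (moves-refl (b 0))
moves-schedule b (suc T) = ≤-trans (moves-triangle (b 0) (b T) (b (suc T))) (+-monoˡ-≤ _ (moves-schedule b T))

sum-load : ∀ {n ℓ} (a : Assignment n ℓ) → sum (load a) ≡ n
sum-load {n} {ℓ} a = begin
  sum (load a)                              ≡⟨ sum-cong-≗ (load-sum a) ⟩
  sum (λ s → sum (λ v → [ a v ≟ s ]ᵢ))      ≡⟨ ∑-comm (λ s v → [ a v ≟ s ]ᵢ) ⟩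
  sum (λ v → sum (λ s → [ a v ≟ s ]ᵢ))      ≡⟨ sum-cong-≗ (λ v → sum-indicator (a v)) ⟩
  sum {n} (λ _ → 1)                         ≡⟨ sum-const n 1 ⟩
  n * 1                                     ≡⟨ *-identityʳ n ⟩
  n                                         ∎
  where open ≡-Reasoning

overflow : ∀ {n ℓ} → ℕ → Assignment n ℓ → ℕ
overflow cap a = sum (λ s → load a s ∸ cap)

-- A moved vertex raises the load of exactly one server, by one; `incoming` counts these arrivals,
-- and summing over servers counts each moved vertex once.
overflow-moves : ∀ {n ℓ} cap (a b : Assignment n ℓ) → overflow cap b ≤ overflow cap a + moves a b
overflow-moves {n} {ℓ} cap a b = begin
  overflow cap b                                    ≤⟨ sum-mono (λ s → server s) ⟩
  sum (λ s → (load a s ∸ cap) + incoming s)         ≡⟨ ∑-distrib-+ (λ s → load a s ∸ cap) incoming ⟩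
  overflow cap a + sum incoming                     ≡⟨ cong (overflow cap a +_) (∑-comm (λ s v → moved v * [ b v ≟ s ]ᵢ)) ⟩
  overflow cap a + sum (λ v → sum (λ s → moved v * [ b v ≟ s ]ᵢ)) ≡⟨ cong (overflow cap a +_) (sum-cong-≗ once) ⟩
  overflow cap a + sum moved                        ≡⟨ cong (overflow cap a +_) (sym (moves-sum a b)) ⟩
  overflow cap a + moves a b                        ∎
  where
  open ≤-Reasoning
  moved : Fin n → ℕ
  moved v = [ ¬? (a v ≟ b v) ]ᵢ
  incoming : Fin ℓ → ℕ
  incoming s = sum (λ v → moved v * [ b v ≟ s ]ᵢ)
  once : ∀ v → sum (λ s → moved v * [ b v ≟ s ]ᵢ) ≡ moved v
  once v = trans (sym (*-distribˡ-sum (moved v) (λ s → [ b v ≟ s ]ᵢ)))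
                 (trans (cong (moved v *_) (sum-indicator (b v))) (*-identityʳ _))
  pointwise : ∀ s v → [ b v ≟ s ]ᵢ ≤ [ a v ≟ s ]ᵢ + moved v * [ b v ≟ s ]ᵢ
  pointwise s v with b v ≟ s | a v ≟ s | a v ≟ b v
  ... | no _  | _     | _     = z≤n
  ... | yes _ | yes _ | _     = s≤s z≤n
  ... | yes _ | no  _ | no  _ = ≤-refl
  ... | yes p | no  q | yes r = ⊥-elim (q (trans r p))
  grow : ∀ s → load b s ≤ load a s + incoming s
  grow s rewrite load-sum a s | load-sum b s =
    ≤-trans (sum-mono (pointwise s)) (≤-reflexive (∑-distrib-+ (λ v → [ a v ≟ s ]ᵢ) (λ v → moved v * [ b v ≟ s ]ᵢ)))
  server : ∀ s → load b s ∸ cap ≤ (load a s ∸ cap) + incoming s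
  server s = m≤n+o⇒m∸n≤o (load b s) cap (begin
    load b s                                ≤⟨ grow s ⟩
    load a s + incoming s                   ≤⟨ +-monoˡ-≤ _ (m≤n+m∸n (load a s) cap) ⟩
    cap + (load a s ∸ cap) + incoming s     ≡⟨ +-assoc cap _ _ ⟩
    cap + ((load a s ∸ cap) + incoming s)   ∎)

-- Pigeonhole: loads that all exceed `k` would sum to more than `n`. The argument of type `Fin ℓ`
-- excludes the case of no servers.
light-server : ∀ {n ℓ k} → n ≤ ℓ * k → Fin ℓ → (a : Assignment n ℓ) → ∃ λ r → load a r ≤ k
light-server {n} {suc ℓ} {k} n≤ℓk _ a with any? (λ r → load a r ≤? k)
... | yes p = p
... | no ¬p = ⊥-elim (<-irrefl refl (begin-strict
  suc ℓ * k           ≡⟨ sum-const (suc ℓ) k ⟨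
  sum {suc ℓ} (λ _ → k) <⟨ +-mono-<-≤ (heavy zero) (sum-mono (λ r → <⇒≤ (heavy (suc r)))) ⟩
  sum (load a)        ≡⟨ sum-load a ⟩
  n                   ≤⟨ n≤ℓk ⟩
  suc ℓ * k           ∎))
  where
  open ≤-Reasoning
  heavy : ∀ r → k < load a r
  heavy r = ≰⇒> (λ le → ¬p (r , le))

-- Components

-- Components are labelled by vertices. After a merge of distinct labels, `x` survives as the label
-- of an empty component, so sums over components always range over `Fin n`.
relabel : ∀ {n} → (Fin n → Fin n) → Fin n → Fin n → Fin n → Fin n
relabel comp x y v = if does (comp v ≟ x) then y else comp v

relocate : ∀ {n ℓ} → (Fin n → Fin ℓ) → Fin n → Fin ℓ → Fin n → Fin ℓ
relocate place y r c = if does (c ≟ y) then r else place c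

relocate-at : ∀ {n ℓ} (place : Fin n → Fin ℓ) y r → relocate place y r y ≡ r
relocate-at place y r with y ≟ y
... | yes _ = refl
... | no ne = ⊥-elim (ne refl)

relocate-off : ∀ {n ℓ} (place : Fin n → Fin ℓ) y r {c} → c ≢ y → relocate place y r c ≡ place c
relocate-off place y r {c} c≢y with c ≟ y
... | yes eq = ⊥-elim (c≢y eq)
... | no _   = refl

mass : ∀ {n} → (Fin n → Fin n) → (Fin n → ℕ) → Fin n → ℕ
mass comp w c = sum (λ v → [ comp v ≟ c ]ᵢ * w v)

mass-mono : ∀ {n} (comp : Fin n → Fin n) {w w′ : Fin n → ℕ} c →
  (∀ v → comp v ≡ c → w v ≤ w′ v) → mass comp w c ≤ mass comp w′ c
mass-mono comp {w} {w′} c le = sum-mono pointwise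
  where
  pointwise : ∀ v → [ comp v ≟ c ]ᵢ * w v ≤ [ comp v ≟ c ]ᵢ * w′ v
  pointwise v with comp v ≟ c
  ... | yes eq = +-monoˡ-≤ 0 (le v eq)
  ... | no _   = z≤n

mass-zero : ∀ {n} (comp : Fin n → Fin n) c → mass comp (λ _ → 0) c ≡ 0
mass-zero {n} comp c = trans (sum-cong-≗ (λ v → *-zeroʳ [ comp v ≟ c ]ᵢ)) (sum-zero n)

mass-+ : ∀ {n} (comp : Fin n → Fin n) (w w′ : Fin n → ℕ) c →
  mass comp (λ v → w v + w′ v) c ≡ mass comp w c + mass comp w′ c
mass-+ comp w w′ c = trans (sum-cong-≗ (λ v → *-distribˡ-+ [ comp v ≟ c ]ᵢ (w v) (w′ v)))
  (∑-distrib-+ (λ v → [ comp v ≟ c ]ᵢ * w v) (λ v → [ comp v ≟ c ]ᵢ * w′ v))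

-- Double counting: every vertex carries exactly one label.
sum-mass : ∀ {n} (comp : Fin n → Fin n) (w : Fin n → ℕ) → sum (mass comp w) ≡ sum w
sum-mass {n} comp w = trans (∑-comm (λ c v → [ comp v ≟ c ]ᵢ * w v)) (sum-cong-≗ once)
  where
  once : ∀ v → sum (λ c → [ comp v ≟ c ]ᵢ * w v) ≡ w v
  once v = trans (sym (*-distribʳ-sum (w v) (λ c → [ comp v ≟ c ]ᵢ)))
                 (trans (cong (_* w v) (sum-indicator (comp v))) (*-identityˡ (w v)))

module _ {n} (comp : Fin n → Fin n) {x y : Fin n} (x≢y : x ≢ y) (w : Fin n → ℕ) where

  mass-relabel-target : mass (relabel comp x y) w y ≡ mass comp w x + mass comp w y
  mass-relabel-target = trans (sum-cong-≗ pointwise)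
    (∑-distrib-+ (λ v → [ comp v ≟ x ]ᵢ * w v) (λ v → [ comp v ≟ y ]ᵢ * w v))
    where
    pointwise : ∀ v → [ relabel comp x y v ≟ y ]ᵢ * w v ≡ [ comp v ≟ x ]ᵢ * w v + [ comp v ≟ y ]ᵢ * w v
    pointwise v with comp v ≟ x
    pointwise v | no _ = refl
    pointwise v | yes eq with y ≟ y | comp v ≟ y
    ... | no ne | _       = ⊥-elim (ne refl)
    ... | yes _ | yes eq′ = ⊥-elim (x≢y (trans (sym eq) eq′))
    ... | yes _ | no _    = sym (+-identityʳ _)

  mass-relabel-source : mass (relabel comp x y) w x ≡ 0
  mass-relabel-source = trans (sum-cong-≗ pointwise) (sum-zero n)
    where
    pointwise : ∀ v → [ relabel comp x y v ≟ x ]ᵢ * w v ≡ 0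
    pointwise v with comp v ≟ x
    pointwise v | no ne with comp v ≟ x
    ... | yes eq = ⊥-elim (ne eq)
    ... | no _   = refl
    pointwise v | yes _ with y ≟ x
    ... | yes eq = ⊥-elim (x≢y (sym eq))
    ... | no _   = refl

  mass-relabel-off : ∀ {c} → c ≢ x → c ≢ y → mass (relabel comp x y) w c ≡ mass comp w c
  mass-relabel-off {c} c≢x c≢y = sum-cong-≗ pointwise
    where
    pointwise : ∀ v → [ relabel comp x y v ≟ c ]ᵢ * w v ≡ [ comp v ≟ c ]ᵢ * w v
    pointwise v with comp v ≟ x
    pointwise v | no _ = refl
    pointwise v | yes eq with y ≟ c | comp v ≟ c
    ... | yes eq′ | _       = ⊥-elim (c≢y (sym eq′))
    ... | no _    | yes eq′ = ⊥-elim (c≢x (trans (sym eq′) eq))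
    ... | no _    | no _    = refl

size : ∀ {n} → (Fin n → Fin n) → Fin n → ℕ
size comp = mass comp (λ _ → 1)

size-inhabited : ∀ {n} (comp : Fin n → Fin n) u → 1 ≤ size comp (comp u)
size-inhabited {n} comp u = subst (_≤ size comp (comp u)) (sum-indicator u) (sum-mono pointwise)
  where
  pointwise : ∀ v → [ u ≟ v ]ᵢ ≤ [ comp v ≟ comp u ]ᵢ * 1
  pointwise v with u ≟ v | comp v ≟ comp u
  ... | no _     | _     = z≤n
  ... | yes _    | yes _ = ≤-refl
  ... | yes refl | no ne = ⊥-elim (ne refl)

module _ {n ℓ} (comp : Fin n → Fin n) (place : Fin n → Fin ℓ) where

  -- A correction on each side lets one equation cover the old server, the new server and all
  -- others, even if old and new coincide, without subtraction.
  load-relocate : ∀ y r s →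
    load (relocate place y r ∘ comp) s + [ place y ≟ s ]ᵢ * size comp y
      ≡ load (place ∘ comp) s + [ r ≟ s ]ᵢ * size comp y
  load-relocate y r s = begin
    load (relocate place y r ∘ comp) s + [ place y ≟ s ]ᵢ * size comp y
      ≡⟨ cong₂ _+_ (load-sum (relocate place y r ∘ comp) s) (*-distribˡ-sum [ place y ≟ s ]ᵢ member) ⟩
    sum (λ v → [ relocate place y r (comp v) ≟ s ]ᵢ) + sum (λ v → [ place y ≟ s ]ᵢ * member v)
      ≡⟨ ∑-distrib-+ (λ v → [ relocate place y r (comp v) ≟ s ]ᵢ) (λ v → [ place y ≟ s ]ᵢ * member v) ⟨
    sum (λ v → [ relocate place y r (comp v) ≟ s ]ᵢ + [ place y ≟ s ]ᵢ * member v)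
      ≡⟨ sum-cong-≗ pointwise ⟩
    sum (λ v → [ place (comp v) ≟ s ]ᵢ + [ r ≟ s ]ᵢ * member v)
      ≡⟨ ∑-distrib-+ (λ v → [ place (comp v) ≟ s ]ᵢ) (λ v → [ r ≟ s ]ᵢ * member v) ⟩
    sum (λ v → [ place (comp v) ≟ s ]ᵢ) + sum (λ v → [ r ≟ s ]ᵢ * member v)
      ≡⟨ cong₂ _+_ (load-sum (place ∘ comp) s) (*-distribˡ-sum [ r ≟ s ]ᵢ member) ⟨
    load (place ∘ comp) s + [ r ≟ s ]ᵢ * size comp y ∎
    where
    open ≡-Reasoning
    member : Fin n → ℕ
    member v = [ comp v ≟ y ]ᵢ * 1
    swap : ∀ a b → a + b * 1 ≡ b + a * 1
    swap = solve-∀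
    stay : ∀ a b c → a + b * 0 ≡ a + c * 0
    stay = solve-∀
    pointwise : ∀ v → [ relocate place y r (comp v) ≟ s ]ᵢ + [ place y ≟ s ]ᵢ * member v
                    ≡ [ place (comp v) ≟ s ]ᵢ + [ r ≟ s ]ᵢ * member v
    pointwise v with comp v ≟ y
    ... | no _     = stay [ place (comp v) ≟ s ]ᵢ [ place y ≟ s ]ᵢ [ r ≟ s ]ᵢ
    ... | yes refl = swap [ r ≟ s ]ᵢ [ place y ≟ s ]ᵢ

  moves-relocate : ∀ y r → moves (place ∘ comp) (relocate place y r ∘ comp) ≤ size comp y
  moves-relocate y r = moves-≤ (place ∘ comp) (relocate place y r ∘ comp) pointwise
    where
    pointwise : ∀ v → place (comp v) ≢ relocate place y r (comp v) → 1 ≤ [ comp v ≟ y ]ᵢ * 1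
    pointwise v ne with comp v ≟ y
    ... | yes _ = ≤-refl
    ... | no _  = ⊥-elim (ne refl)

  moves-relabel : ∀ x y → moves (place ∘ comp) (place ∘ relabel comp x y) ≤ size comp x
  moves-relabel x y = moves-≤ (place ∘ comp) (place ∘ relabel comp x y) pointwise
    where
    pointwise : ∀ v → place (comp v) ≢ place (relabel comp x y v) → 1 ≤ [ comp v ≟ x ]ᵢ * 1
    pointwise v ne with comp v ≟ x
    ... | yes _ = ≤-refl
    ... | no _  = ⊥-elim (ne refl)

  moves-relabel-together : ∀ x y → place x ≡ place y → moves (place ∘ comp) (place ∘ relabel comp x y) ≡ 0
  moves-relabel-together x y eq = moves-≗ (place ∘ comp) (place ∘ relabel comp x y) pointwise
    where
    pointwise : ∀ v → place (comp v) ≡ place (relabel comp x y v)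
    pointwise v with comp v ≟ x
    ... | yes refl = eq
    ... | no _     = refl

-- Initial servers, majority origins and credit

module _ {n ℓ} (init : Assignment n ℓ) where

  -- These vertices must move if c is to lie on r.
  others : (Fin n → Fin n) → Fin ℓ → Fin n → ℕ
  others comp r = mass comp (λ v → [ ¬? (init v ≟ r) ]ᵢ)

  natives : (Fin n → Fin n) → Fin ℓ → Fin n → ℕ
  natives comp r = mass comp (λ v → [ init v ≟ r ]ᵢ)

  natives+others : ∀ comp r c → size comp c ≡ natives comp r c + others comp r c
  natives+others comp r c = trans (sum-cong-≗ (λ v → cong ([ comp v ≟ c ]ᵢ *_) (split v)))
    (mass-+ comp (λ v → [ init v ≟ r ]ᵢ) (λ v → [ ¬? (init v ≟ r) ]ᵢ) c)
    where
    split : ∀ v → 1 ≡ [ init v ≟ r ]ᵢ + [ ¬? (init v ≟ r) ]ᵢ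
    split v with init v ≟ r
    ... | yes _ = refl
    ... | no  _ = refl

  -- No vertex starts on both servers. Consequently a component cannot be mostly native to two of
  -- them.
  others-cover : ∀ comp {r r′} c → r ≢ r′ → size comp c ≤ others comp r c + others comp r′ c
  others-cover comp {r} {r′} c r≢r′ = ≤-trans (mass-mono comp c (λ v _ → cover v))
    (≤-reflexive (mass-+ comp (λ v → [ ¬? (init v ≟ r) ]ᵢ) (λ v → [ ¬? (init v ≟ r′) ]ᵢ) c))
    where
    cover : ∀ v → 1 ≤ [ ¬? (init v ≟ r) ]ᵢ + [ ¬? (init v ≟ r′) ]ᵢ
    cover v with init v ≟ r | init v ≟ r′
    ... | yes p | yes q = ⊥-elim (r≢r′ (trans (sym p) q))
    ... | yes _ | no  _ = ≤-refl
    ... | no  _ | _     = s≤s z≤n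

  -- At least half of every component on `s` is native to `s`, and `s` has only `load init s`
  -- natives in total. This bounds what eviction has to leave behind.
  load-majority : ∀ comp (place : Fin n → Fin ℓ) s →
    (∀ c → place c ≡ s → 2 * others comp s c ≤ size comp c) →
    load (place ∘ comp) s ≤ 2 * load init s
  load-majority comp place s major = begin
    load (place ∘ comp) s                        ≡⟨ load-sum (place ∘ comp) s ⟩
    sum here-weight                              ≡⟨ sum-mass comp here-weight ⟨
    sum (mass comp here-weight)                  ≤⟨ sum-mono component ⟩
    sum (λ c → 2 * natives comp s c)             ≡⟨ *-distribˡ-sum 2 (natives comp s) ⟨
    2 * sum (natives comp s)                     ≡⟨ cong (2 *_) (sum-mass comp (λ v → [ init v ≟ s ]ᵢ)) ⟩
    2 * sum (λ v → [ init v ≟ s ]ᵢ)              ≡⟨ cong (2 *_) (load-sum init s) ⟨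
    2 * load init s                              ∎
    where
    open ≤-Reasoning
    here-weight : Fin n → ℕ
    here-weight v = [ place (comp v) ≟ s ]ᵢ
    arith : ∀ m o z → z ≡ m + o → 2 * o ≤ z → z ≤ 2 * m
    arith m o z refl le = ≤-from 0 le (eq m o)
      where
      eq : ∀ m o → m + o + (m + o) + 0 ≡ 2 * m + 2 * o
      eq = solve-∀
    at-most-one : ∀ v → here-weight v ≤ 1
    at-most-one v with place (comp v) ≟ s
    ... | yes _ = ≤-refl
    ... | no  _ = z≤n
    absent : ∀ {c} → place c ≢ s → ∀ v → comp v ≡ c → here-weight v ≤ 0
    absent ne v refl with place (comp v) ≟ s
    ... | yes eq = ⊥-elim (ne eq)
    ... | no _   = z≤n
    component : ∀ c → mass comp here-weight c ≤ 2 * natives comp s c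
    component c with place c ≟ s
    ... | yes eq = ≤-trans (mass-mono comp c (λ v _ → at-most-one v))
                           (arith (natives comp s c) (others comp s c) (size comp c) (natives+others comp s c) (major c eq))
    ... | no ne  = ≤-trans (mass-mono comp c (absent ne)) (≤-trans (≤-reflexive (mass-zero comp c)) z≤n)

  -- Zero unless some server other than s is the initial server of a majority of c.
  excess : (Fin n → Fin n) → Fin ℓ → Fin n → ℕ
  excess comp s c = sup (λ r → [ ¬? (r ≟ s) ]ᵢ * (size comp c ∸ 2 * others comp r c))

  ≤-excess : ∀ comp {s r} c → r ≢ s → size comp c ∸ 2 * others comp r c ≤ excess comp s c
  ≤-excess comp {s} {r} c r≢s = ≤-trans pointwise (≤-sup (λ r → [ ¬? (r ≟ s) ]ᵢ * (size comp c ∸ 2 * others comp r c)) r)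
    where
    pointwise : size comp c ∸ 2 * others comp r c ≤ [ ¬? (r ≟ s) ]ᵢ * (size comp c ∸ 2 * others comp r c)
    pointwise with r ≟ s
    ... | yes eq = ⊥-elim (r≢s eq)
    ... | no _   = ≤-reflexive (sym (+-identityʳ _))

  excess-≤ : ∀ comp s c {b} → (∀ r → r ≢ s → size comp c ≤ 2 * others comp r c + b) → excess comp s c ≤ b
  excess-≤ comp s c {b} le = sup-least (λ r → [ ¬? (r ≟ s) ]ᵢ * (size comp c ∸ 2 * others comp r c)) pointwise
    where
    pointwise : ∀ r → [ ¬? (r ≟ s) ]ᵢ * (size comp c ∸ 2 * others comp r c) ≤ b
    pointwise r with r ≟ s
    ... | yes _ = z≤n
    ... | no ne = ≤-trans (≤-reflexive (+-identityʳ _)) (m≤n+o⇒m∸n≤o (size comp c) _ (le r ne))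

  size-≤-excess : ∀ comp {s r} c → r ≢ s → size comp c ≤ 2 * others comp r c + excess comp s c
  size-≤-excess comp {s} {r} c r≢s =
    ≤-trans (m≤n+m∸n (size comp c) (2 * others comp r c)) (+-monoʳ-≤ _ (≤-excess comp c r≢s))

  -- Up to the factor 8, a lower bound on the offline cost of c, capped at the size of c.
  charge : (Fin n → Fin n) → Fin n → ℕ
  charge comp c = inf (size comp c) (λ r → 8 * others comp r c)

  charge-≤-size : ∀ comp c → charge comp c ≤ size comp c
  charge-≤-size comp c = inf-≤-bound (size comp c) (λ r → 8 * others comp r c)

  charge-≤-others : ∀ comp c r → charge comp c ≤ 8 * others comp r c
  charge-≤-others comp c r = inf-≤ (size comp c) (λ r → 8 * others comp r c) r

  -- The summand 1 keeps the factor positive even for singletons, so a growth of `charge` counts at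
  -- least at face value as long as the size does not drop.
  credit : (Fin n → Fin n) → Fin n → ℕ
  credit comp c = charge comp c * (1 + ⌊log₂ size comp c ⌋)

  module _ (comp : Fin n → Fin n) {x y : Fin n} (x≢y : x ≢ y) (x≤y : size comp x ≤ size comp y) where

    private
      comp′ = relabel comp x y
      sx = size comp x
      sy = size comp y
      gx = charge comp x
      gy = charge comp y
      level : ℕ → ℕ
      level m = 1 + ⌊log₂ m ⌋

      size-merged : size comp′ y ≡ sx + sy
      size-merged = mass-relabel-target comp x≢y (λ _ → 1)

      others-merged : ∀ r → others comp′ r y ≡ others comp r x + others comp r y
      others-merged r = mass-relabel-target comp x≢y (λ v → [ ¬? (init v ≟ r) ]ᵢ)

      -- All terms are raised to the level of the union, which is at least 1, and the level is then
      -- factored out.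
      credit-+ : ∀ e → gx + gy + e ≤ charge comp′ y → credit comp x + credit comp y + e ≤ credit comp′ y
      credit-+ e le = begin
        credit comp x + credit comp y + e
          ≤⟨ +-mono-≤ (+-mono-≤ (*-monoʳ-≤ gx (mono (m≤m+n sx sy))) (*-monoʳ-≤ gy (mono (m≤n+m sy sx)))) (m≤m*n e _) ⟩
        gx * level (sx + sy) + gy * level (sx + sy) + e * level (sx + sy)
          ≡⟨ distrib gx gy e (level (sx + sy)) ⟩
        (gx + gy + e) * level (sx + sy)
          ≤⟨ *-monoˡ-≤ (level (sx + sy)) le ⟩
        charge comp′ y * level (sx + sy)
          ≡⟨ cong (λ m → charge comp′ y * level m) size-merged ⟨
        credit comp′ y ∎
        where
        open ≤-Reasoning
        mono : ∀ {m m′} → m ≤ m′ → level m ≤ level m′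
        mono le = s≤s (⌊log₂⌋-mono-≤ le)
        distrib : ∀ a b c d → a * d + b * d + c * d ≡ (a + b + c) * d
        distrib = solve-∀

      -- The smaller part at least doubles when it enters the union; nonemptiness is what makes the
      -- logarithm of the double rise by one.
      level-double : 1 ≤ sx → 1 + level sx ≤ level (sx + sy)
      level-double 1≤sx = s≤s (begin
        1 + ⌊log₂ sx ⌋        ≡⟨ ⌊log₂[2*b]⌋≡1+⌊log₂b⌋ sx {{>-nonZero 1≤sx}} ⟨
        ⌊log₂ (2 * sx) ⌋      ≤⟨ ⌊log₂⌋-mono-≤ (+-monoʳ-≤ sx (≤-trans (≤-reflexive (+-identityʳ sx)) x≤y)) ⟩
        ⌊log₂ (sx + sy) ⌋     ∎)
        where open ≤-Reasoning

      -- A fully charged union pays for the move because the level of x rises by one.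
      credit-full : 1 ≤ sx → charge comp′ y ≡ size comp′ y → credit comp x + credit comp y + sx ≤ credit comp′ y
      credit-full 1≤sx eq = begin
        gx * level sx + gy * level sy + sx
          ≤⟨ +-monoˡ-≤ sx (+-mono-≤ (*-monoˡ-≤ (level sx) (charge-≤-size comp x)) (*-mono-≤ (charge-≤-size comp y) (s≤s (⌊log₂⌋-mono-≤ (m≤n+m sy sx))))) ⟩
        sx * level sx + sy * level (sx + sy) + sx
          ≡⟨ regroup sx sy (level sx) (level (sx + sy)) ⟩
        sx * (1 + level sx) + sy * level (sx + sy)
          ≤⟨ +-monoˡ-≤ _ (*-monoʳ-≤ sx (level-double 1≤sx)) ⟩
        sx * level (sx + sy) + sy * level (sx + sy)
          ≡⟨ *-distribʳ-+ (level (sx + sy)) sx sy ⟨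
        (sx + sy) * level (sx + sy)
          ≡⟨ cong₂ (λ g m → g * level m) (trans eq size-merged) size-merged ⟨
        credit comp′ y ∎
        where
        open ≤-Reasoning
        regroup : ∀ a b c d → a * c + b * d + a ≡ a * (1 + c) + b * d
        regroup = solve-∀

    -- Size and, for each fixed `r`, `others` are additive under a merge. A minimum of additive
    -- quantities is superadditive, so `charge` does not lose anything.
    credit-merge-together : credit comp x + credit comp y + 0 ≤ credit comp′ y
    credit-merge-together = credit-+ 0 le
      where
      le : gx + gy + 0 ≤ charge comp′ y
      le = inf-greatest
        (begin
          gx + gy + 0   ≡⟨ +-identityʳ (gx + gy) ⟩
          gx + gy       ≤⟨ +-mono-≤ (charge-≤-size comp x) (charge-≤-size comp y) ⟩
          sx + sy       ≡⟨ size-merged ⟨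
          size comp′ y  ∎)
        (λ r → begin
          gx + gy + 0                                ≡⟨ +-identityʳ (gx + gy) ⟩
          gx + gy                                    ≤⟨ +-mono-≤ (charge-≤-others comp x r) (charge-≤-others comp y r) ⟩
          8 * others comp r x + 8 * others comp r y  ≡⟨ *-distribˡ-+ 8 (others comp r x) (others comp r y) ⟨
          8 * (others comp r x + others comp r y)    ≡⟨ cong (8 *_) (others-merged r) ⟨
          8 * others comp′ r y                       ∎)
        where open ≤-Reasoning

    -- Split on what attains the minimum defining the charge of the union. If it is the size, the
    -- level gain of x pays. If it is a server `r`, the charge itself grows, because one of the
    -- parts has at least a quarter of its vertices foreign to `r`.
    credit-merge-apart : 1 ≤ sx → (∀ r → sx ≤ 4 * others comp r x ⊎ sy ≤ 4 * others comp r y) →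
      credit comp x + credit comp y + sx ≤ credit comp′ y
    credit-merge-apart 1≤sx foreign with inf-attained (size comp′ y) (λ r → 8 * others comp′ r y)
    ... | inj₁ eq = credit-full 1≤sx eq
    ... | inj₂ (r , eq) = credit-+ sx (≤-trans le (≤-reflexive (trans (cong (8 *_) (sym (others-merged r))) (sym eq))))
      where
      e₁ : ∀ gx gy sx ox oy → gx + gy + sx + (sx + 2 * (4 * ox) + 8 * oy) + 0 ≡ 8 * (ox + oy) + (gx + 2 * sx + gy)
      e₁ = solve-∀
      e₂ : ∀ gx gy sx sy ox oy → gx + gy + sx + (8 * ox + (sy + (sy + 2 * (4 * oy)))) + 0 ≡ 8 * (ox + oy) + (gx + (sx + (gy + 2 * sy)))
      e₂ = solve-∀
      le : gx + gy + sx ≤ 8 * (others comp r x + others comp r y)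
      le with foreign r
      -- Here 8 is twice 4: the new charge contains 8 `others` of x, at least 2 `sx`, which covers
      -- both the old charge of x and the move.
      ... | inj₁ fx = ≤-from 0
        (+-mono-≤ (+-mono-≤ (charge-≤-size comp x) (*-monoʳ-≤ 2 fx)) (charge-≤-others comp y r))
        (e₁ gx gy sx (others comp r x) (others comp r y))
      -- The same surplus comes from y: 2 `sy` covers the old charge of y and, since x is the
      -- smaller part, the move of x.
      ... | inj₂ fy = ≤-from 0
        (+-mono-≤ (charge-≤-others comp x r) (+-mono-≤ x≤y (+-mono-≤ (charge-≤-size comp y) (*-monoʳ-≤ 2 fy))))
        (e₂ gx gy sx sy (others comp r x) (others comp r y))

    credit-source : credit comp′ x ≡ 0
    credit-source = cong (_* level (size comp′ x))
      (n≤0⇒n≡0 (≤-trans (charge-≤-size comp′ x) (≤-reflexive (mass-relabel-source comp x≢y (λ _ → 1)))))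

    credit-off : ∀ c → c ≢ x → c ≢ y → credit comp c ≤ credit comp′ c
    credit-off c c≢x c≢y = *-mono-≤
      (inf-greatest
        (≤-trans (charge-≤-size comp c) (≤-reflexive (sym size-off)))
        (λ r → ≤-trans (charge-≤-others comp c r) (≤-reflexive (cong (8 *_) (sym (mass-relabel-off comp x≢y _ c≢x c≢y))))))
      (≤-reflexive (cong level (sym size-off)))
      where
      size-off : size comp′ c ≡ size comp c
      size-off = mass-relabel-off comp x≢y (λ _ → 1) c≢x c≢y

-- The online algorithm

-- Servers are attached to labels and not to vertices, so equally labelled vertices share a server
-- by construction.
record State (n ℓ : ℕ) : Set where
  constructor ⟨_,_⟩
  field
    comp  : Fin n → Fin n
    place : Fin n → Fin ℓ

open State

assignment : ∀ {n ℓ} → State n ℓ → Assignment n ℓ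
assignment S = place S ∘ comp S

module _ {n ℓ} (p q k : ℕ) (init : Assignment n ℓ) where

  module _ (comp : Fin n → Fin n) where

    rehome : Fin n → (Fin n → Fin ℓ) → Fin n → Fin ℓ
    rehome y place with any? (λ r → ¬? (r ≟ place y) ×-dec (4 * others init comp r y <? size comp y))
    ... | yes (r , _) = relocate place y r
    ... | no _        = place

    -- The fallback s is never needed: the average load is at most k.
    light : Fin ℓ → (Fin n → Fin ℓ) → Fin ℓ
    light s place with any? (λ r → load (place ∘ comp) r ≤? k)
    ... | yes (r , _) = r
    ... | no _        = s

    -- The load is tested anew before each component. Eviction thus stops at the first load of at
    -- most 2k, and overshoots by no more than one component.
    evict₁ : Fin ℓ → (Fin n → Fin ℓ) → Fin n → Fin n → Fin ℓ
    evict₁ s place c with (place c ≟ s) ×-dec (size comp c ≤? 2 * others init comp s c) ×-dec (2 * k <? load (place ∘ comp) s)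
    ... | yes _ = relocate place c (light s place)
    ... | no _  = place

    evict : Fin ℓ → (Fin n → Fin ℓ) → Fin n → Fin ℓ
    evict s place = foldl (evict₁ s) place (allFin n)

    settle₁ : (Fin n → Fin ℓ) → Fin ℓ → Fin n → Fin ℓ
    settle₁ place s with q * load (place ∘ comp) s ≤? (q + p) * k
    ... | yes _ = place
    ... | no _  = evict s place

    -- One pass suffices: with component sizes at most `k`, a receiver ends with load at most 2k and
    -- no other load grows, so servers already treated stay feasible.
    settle : (Fin n → Fin ℓ) → Fin n → Fin ℓ
    settle place = foldl settle₁ place (allFin ℓ)

  -- Only the union can have acquired a new dominant origin, so `rehome` inspects `y` alone.
  -- `settle` comes last because the merge and the return may both overload a server.
  absorb : Fin n → Fin n → State n ℓ → State n ℓ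
  absorb x y S = ⟨ relabel (comp S) x y , settle comp′ (rehome comp′ y (place S)) ⟩
    where comp′ = relabel (comp S) x y

  step : State n ℓ → Edge n → State n ℓ
  step S (u , v) with comp S u ≟ comp S v
  ... | yes _ = S
  ... | no _ with size (comp S) (comp S u) ≤? size (comp S) (comp S v)
  ...   | yes _ = absorb (comp S u) (comp S v) S
  ...   | no _  = absorb (comp S v) (comp S u) S

  start : State n ℓ
  start = ⟨ id , init ⟩

-- Eviction

module Eviction {n ℓ} (p q k : ℕ) (init : Assignment n ℓ) (comp : Fin n → Fin n)
  (q<p : q < p) (n≤ℓk : n ≤ ℓ * k) (balanced : Balanced k init) (small : ∀ c → size comp c ≤ k) where

  ld : (Fin n → Fin ℓ) → Fin ℓ → ℕ
  ld place = load (place ∘ comp)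

  Feasible : (Fin n → Fin ℓ) → Fin ℓ → Set
  Feasible place s = q * ld place s ≤ (q + p) * k

  -- Components leave a server only if it is not the initial server of their majority,
  -- so neither the anchoring invariant nor the excess can get worse.
  Quiet : (Fin n → Fin ℓ) → (Fin n → Fin ℓ) → Set
  Quiet place place′ = ∀ c r → r ≢ place′ c → r ≢ place c ⊎ size comp c ≤ 2 * others init comp r c

  quiet-trans : ∀ {a b c} → Quiet a b → Quiet b c → Quiet a c
  quiet-trans ab bc c r ne with bc c r ne
  ... | inj₁ ne′ = ab c r ne′
  ... | inj₂ le  = inj₂ le

  light-≤ : ∀ s place → ld place (light p q k init comp s place) ≤ k
  light-≤ s place with any? (λ r → ld place r ≤? k)
  ... | yes (_ , le) = le
  ... | no ¬p        = ⊥-elim (¬p (light-server n≤ℓk s (place ∘ comp)))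

  module _ (s : Fin ℓ) where

    -- `cost` charges each move to a unit of load leaving `s`, and `floor` limits how much can
    -- leave. By `back` nothing enters `s`, which keeps verdicts on earlier components valid.
    record Evicted (place place′ : Fin n → Fin ℓ) : Set where
      field
        loads : ∀ r → ld place′ r ≤ ld place r ⊎ ld place′ r ≤ 2 * k
        cost  : moves (place ∘ comp) (place′ ∘ comp) + ld place′ s ≤ ld place s
        floor : k ≤ ld place s → k ≤ ld place′ s
        back  : ∀ c → place′ c ≡ s → place c ≡ s
        quiet : Quiet place place′

    -- Loop invariant after examining `cs`: either the goal is reached, or the survivors on `s`
    -- satisfy the hypothesis of `load-majority`, which applies once all labels are examined.
    Done : (Fin n → Fin ℓ) → List (Fin n) → Set
    Done place cs = ld place s ≤ 2 * k ⊎ All (λ c → place c ≡ s → 2 * others init comp s c ≤ size comp c) cs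

    evicted-refl : ∀ place → Evicted place place
    evicted-refl place = record
      { loads = λ _ → inj₁ ≤-refl
      ; cost  = ≤-reflexive (cong (_+ ld place s) (moves-refl (place ∘ comp)))
      ; floor = id
      ; back  = λ _ → id
      ; quiet = λ _ _ → inj₁
      }

    evicted-trans : ∀ {a b c} → Evicted a b → Evicted b c → Evicted a c
    evicted-trans {a} {b} {c} ab bc = record
      { loads = loads′
      ; cost  = begin
          moves (a ∘ comp) (c ∘ comp) + ld c s
            ≤⟨ +-monoˡ-≤ (ld c s) (moves-triangle (a ∘ comp) (b ∘ comp) (c ∘ comp)) ⟩
          moves (a ∘ comp) (b ∘ comp) + moves (b ∘ comp) (c ∘ comp) + ld c s
            ≡⟨ +-assoc (moves (a ∘ comp) (b ∘ comp)) _ _ ⟩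
          moves (a ∘ comp) (b ∘ comp) + (moves (b ∘ comp) (c ∘ comp) + ld c s)
            ≤⟨ +-monoʳ-≤ (moves (a ∘ comp) (b ∘ comp)) (Evicted.cost bc) ⟩
          moves (a ∘ comp) (b ∘ comp) + ld b s
            ≤⟨ Evicted.cost ab ⟩
          ld a s ∎
      ; floor = Evicted.floor bc ∘ Evicted.floor ab
      ; back  = λ d → Evicted.back ab d ∘ Evicted.back bc d
      ; quiet = quiet-trans (Evicted.quiet ab) (Evicted.quiet bc)
      }
      where
      open ≤-Reasoning
      loads′ : ∀ r → ld c r ≤ ld a r ⊎ ld c r ≤ 2 * k
      loads′ r with Evicted.loads bc r | Evicted.loads ab r
      ... | inj₂ le | _       = inj₂ le
      ... | inj₁ le | inj₁ le′ = inj₁ (≤-trans le le′)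
      ... | inj₁ le | inj₂ le′ = inj₂ (≤-trans le le′)

    module _ (place : Fin n → Fin ℓ) (c : Fin n) (r : Fin ℓ) (at-s : place c ≡ s)
      (minority : size comp c ≤ 2 * others init comp s c) (heavy : 2 * k < ld place s) (r-light : ld place r ≤ k) where

      private
        place′ = relocate place c r

        r≢s : r ≢ s
        r≢s refl = <⇒≱ heavy (≤-trans r-light (m≤m+n k _))

        gain-r : ∀ {t} → r ≡ t → ld place′ t ≤ ld place t + size comp c
        gain-r {t} eq with r ≟ t | load-relocate comp place c r t
        ... | yes _ | law = ≤-trans (m≤m+n _ _) (≤-reflexive (trans law (cong (ld place t +_) (*-identityˡ (size comp c)))))
        ... | no ne | _   = ⊥-elim (ne eq)

        no-gain : ∀ {t} → r ≢ t → ld place′ t ≤ ld place t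
        no-gain {t} ne with r ≟ t | load-relocate comp place c r t
        ... | yes eq | _   = ⊥-elim (ne eq)
        ... | no _   | law = ≤-trans (m≤m+n _ _) (≤-reflexive (trans law (+-identityʳ _)))

        loss-s : ld place′ s + size comp c ≡ ld place s
        loss-s with place c ≟ s | r ≟ s | load-relocate comp place c r s
        ... | no ne | _      | _   = ⊥-elim (ne at-s)
        ... | yes _ | yes eq | _   = ⊥-elim (r≢s eq)
        ... | yes _ | no _   | law = trans (cong (ld place′ s +_) (sym (*-identityˡ (size comp c)))) (trans law (+-identityʳ _))

      evicted-relocate : Evicted place place′
      evicted-relocate = record
        { loads = loads′
        ; cost  = begin
            moves (place ∘ comp) (place′ ∘ comp) + ld place′ s  ≤⟨ +-monoˡ-≤ _ (moves-relocate comp place c r) ⟩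
            size comp c + ld place′ s                           ≡⟨ +-comm (size comp c) _ ⟩
            ld place′ s + size comp c                           ≡⟨ loss-s ⟩
            ld place s                                          ∎
        -- The load was above 2k and the departing component has size at most `k`.
        ; floor = λ _ → +-cancelʳ-≤ k k (ld place′ s) (begin
            k + k                      ≡⟨ cong (k +_) (+-identityʳ k) ⟨
            2 * k                      ≤⟨ <⇒≤ heavy ⟩
            ld place s                 ≡⟨ loss-s ⟨
            ld place′ s + size comp c  ≤⟨ +-monoʳ-≤ _ (small c) ⟩
            ld place′ s + k            ∎)
        ; back  = back′
        ; quiet = quiet′
        }
        where
        open ≤-Reasoning
        loads′ : ∀ t → ld place′ t ≤ ld place t ⊎ ld place′ t ≤ 2 * k
        loads′ t with r ≟ t
        -- The receiver had load at most `k` and gains one component of size at most `k`.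
        ... | yes refl = inj₂ (≤-trans (gain-r refl) (+-mono-≤ r-light (≤-trans (small c) (≤-reflexive (sym (+-identityʳ k))))))
        ... | no ne    = inj₁ (no-gain ne)
        back′ : ∀ d → place′ d ≡ s → place d ≡ s
        back′ d eq with d ≟ c
        ... | yes refl = at-s
        ... | no _     = eq
        quiet′ : Quiet place place′
        quiet′ d t ne with d ≟ c
        ... | no _ = inj₁ ne
        ... | yes refl with t ≟ s
        -- The server just left is the only one newly counted as foreign to the component, and the
        -- eviction condition bounds precisely this case.
        ...   | yes refl = inj₂ minority
        ...   | no t≢s   = inj₁ (λ eq → t≢s (trans eq at-s))

      evicted-gone : place′ c ≢ s
      evicted-gone eq = r≢s (trans (sym (relocate-at place c r)) eq)

    evict₁-spec : ∀ place c → Evicted place (evict₁ p q k init comp s place c) × Done (evict₁ p q k init comp s place c) (c ∷ [])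
    evict₁-spec place c with (place c ≟ s) ×-dec (size comp c ≤? 2 * others init comp s c) ×-dec (2 * k <? ld place s)
    ... | yes (at-s , minority , heavy) =
      evicted-relocate place c r at-s minority heavy (light-≤ s place) ,
      inj₂ ((λ eq → ⊥-elim (evicted-gone place c r at-s minority heavy (light-≤ s place) eq)) ∷ [])
      where r = light p q k init comp s place
    ... | no ¬p = evicted-refl place , done
      where
      done : Done place (c ∷ [])
      done with 2 * k <? ld place s
      ... | no ¬heavy = inj₁ (≮⇒≥ ¬heavy)
      ... | yes heavy = inj₂ ((λ at-s → ≰⇒≥ (λ minority → ¬p (at-s , minority , heavy))) ∷ [])

    evicts-spec : ∀ cs place → Evicted place (foldl (evict₁ p q k init comp s) place cs) × Done (foldl (evict₁ p q k init comp s) place cs) cs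
    evicts-spec [] place = evicted-refl place , inj₂ []
    evicts-spec (c ∷ cs) place with evict₁-spec place c | evicts-spec cs (evict₁ p q k init comp s place c)
    ... | e₁ , d₁ | e₂ , d₂ = evicted-trans e₁ e₂ , done d₁ d₂
      where
      done : _ → _ → _
      -- Later evictions from `s` cannot raise its load, by their `cost` inequality.
      done (inj₁ le)       _         = inj₁ (≤-trans (≤-trans (m≤n+m _ _) (Evicted.cost e₂)) le)
      done (inj₂ _)        (inj₁ le) = inj₁ le
      done (inj₂ (f ∷ [])) (inj₂ fs) = inj₂ ((λ eq → f (Evicted.back e₂ c eq)) ∷ fs)

    -- If the loop never reached 2k, everything left on `s` is at least half native, and `balanced`
    -- limits the natives to `k`.
    evict-spec : ∀ place → Evicted place (evict p q k init comp s place) × ld (evict p q k init comp s place) s ≤ 2 * k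
    evict-spec place with evicts-spec (allFin n) place
    ... | e , inj₁ le = e , le
    ... | e , inj₂ fs = e , ≤-trans
      (load-majority init comp (evict p q k init comp s place) s (λ c → All.lookup fs (∈-allFin c)))
      (≤-reflexive (cong (2 *_) (balanced s)))

  record Settled (place place′ : Fin n → Fin ℓ) : Set where
    field
      cost  : moves (place ∘ comp) (place′ ∘ comp) + (1 + q) * overflow (2 * k) (place′ ∘ comp)
                ≤ (1 + q) * overflow (2 * k) (place ∘ comp)
      keep  : ∀ r → Feasible place r → Feasible place′ r
      quiet : Quiet place place′

  settled-refl : ∀ place → Settled place place
  settled-refl place = record
    { cost  = ≤-reflexive (cong (_+ (1 + q) * overflow (2 * k) (place ∘ comp)) (moves-refl (place ∘ comp)))
    ; keep  = λ _ → id
    ; quiet = λ _ _ → inj₁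
    }

  settled-trans : ∀ {a b c} → Settled a b → Settled b c → Settled a c
  settled-trans {a} {b} {c} ab bc = record
    { cost  = ≤-from 0 (+-mono-≤ (moves-triangle (a ∘ comp) (b ∘ comp) (c ∘ comp)) (+-mono-≤ (Settled.cost ab) (Settled.cost bc)))
        (eq (moves (a ∘ comp) (c ∘ comp)) (moves (a ∘ comp) (b ∘ comp)) (moves (b ∘ comp) (c ∘ comp))
          ((1 + q) * overflow (2 * k) (a ∘ comp)) ((1 + q) * overflow (2 * k) (b ∘ comp)) ((1 + q) * overflow (2 * k) (c ∘ comp)))
    ; keep  = λ r → Settled.keep bc r ∘ Settled.keep ab r
    ; quiet = quiet-trans (Settled.quiet ab) (Settled.quiet bc)
    }
    where
    eq : ∀ m m₁ m₂ oa ob oc → m + oc + (m₁ + m₂ + (oa + ob)) + 0 ≡ oa + (m + (m₁ + ob + (m₂ + oc)))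
    eq = solve-∀

  -- This is where ε > 1 makes 2k an admissible load.
  feasible-2k : ∀ place r → ld place r ≤ 2 * k → Feasible place r
  feasible-2k place r le = begin
    q * ld place r  ≤⟨ *-monoʳ-≤ q le ⟩
    q * (2 * k)     ≡⟨ eq q k ⟩
    (q + q) * k     ≤⟨ *-monoˡ-≤ k (+-monoʳ-≤ q (<⇒≤ q<p)) ⟩
    (q + p) * k     ∎
    where
    open ≤-Reasoning
    eq : ∀ q k → q * (2 * k) ≡ (q + q) * k
    eq = solve-∀

  -- With `x` the overflow at `s`, the eviction removes all of `x`, creates no overflow elsewhere
  -- and costs at most (1 + q) `x`.
  evict-settled : ∀ place s → ¬ Feasible place s → Settled place (evict p q k init comp s place)
  evict-settled place s infeasible = record
    { cost  = ≤-from 0 (+-mono-≤ moves≤ (*-monoʳ-≤ (1 + q) overflow≤))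
        (eq (moves (place ∘ comp) (place′ ∘ comp)) (1 + q) x (overflow (2 * k) (place ∘ comp)) (overflow (2 * k) (place′ ∘ comp)))
    ; keep  = keep′
    ; quiet = Evicted.quiet e
    }
    where
    place′ = evict p q k init comp s place
    e = proj₁ (evict-spec s place)
    x = ld place s ∸ 2 * k

    eq : ∀ m Q x o o′ → m + Q * o′ + (Q * x + Q * (o + 0)) + 0 ≡ Q * o + (m + Q * (o′ + x))
    eq = solve-∀

    overfull : 2 * k ≤ ld place s
    overfull = ≰⇒≥ (infeasible ∘ feasible-2k place s)

    load-x : ld place s ≡ 2 * k + x
    load-x = sym (m+[n∸m]≡n overfull)

    -- Since p is at least q + 1, infeasibility means q · load exceeds (2q + 1)k; subtracting 2qk
    -- leaves q · x above `k`.
    k≤qx : k ≤ q * x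
    k≤qx = ≤-from 1 (≤-trans (s≤s (*-monoˡ-≤ k (+-monoʳ-≤ q q<p))) (≤-trans (≰⇒> infeasible) (≤-reflexive (cong (q *_) load-x)))) (arith q k x)
      where
      arith : ∀ q k x → k + q * (2 * k + x) + 1 ≡ q * x + suc ((q + suc q) * k)
      arith = solve-∀

    -- The load drops from 2k + `x` to no less than `k`, so at most `k` + `x` vertices move.
    moves≤ : moves (place ∘ comp) (place′ ∘ comp) ≤ (1 + q) * x
    moves≤ = ≤-from 0 (+-mono-≤ (+-mono-≤ (≤-trans (Evicted.cost e) (≤-reflexive load-x)) (Evicted.floor e (≤-trans (m≤m+n k _) overfull))) k≤qx)
      (arith (moves (place ∘ comp) (place′ ∘ comp)) (ld place′ s) k q x)
      where
      arith : ∀ m l k q x → m + (2 * k + x + l + q * x) + 0 ≡ (1 + q) * x + (m + l + k + k)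
      arith = solve-∀

    overflow≤ : overflow (2 * k) (place′ ∘ comp) + x ≤ overflow (2 * k) (place ∘ comp) + 0
    overflow≤ = sum-≤-at₁ (λ r → ld place′ r ∸ 2 * k) (λ r → ld place r ∸ 2 * k) s x 0 (λ r _ → off r)
      (≤-reflexive (trans (cong (_+ x) (m≤n⇒m∸n≡0 (proj₂ (evict-spec s place)))) (sym (+-identityʳ x))))
      where
      off : ∀ r → ld place′ r ∸ 2 * k ≤ ld place r ∸ 2 * k
      off r with Evicted.loads e r
      ... | inj₁ le = ∸-monoˡ-≤ (2 * k) le
      ... | inj₂ le = ≤-trans (≤-reflexive (m≤n⇒m∸n≡0 le)) z≤n

    keep′ : ∀ r → Feasible place r → Feasible place′ r
    keep′ r fr with Evicted.loads e r
    ... | inj₁ le = ≤-trans (*-monoʳ-≤ q le) fr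
    ... | inj₂ le = feasible-2k place′ r le

  settle₁-spec : ∀ place s → Settled place (settle₁ p q k init comp place s) × Feasible (settle₁ p q k init comp place s) s
  settle₁-spec place s with q * ld place s ≤? (q + p) * k
  ... | yes fs = settled-refl place , fs
  ... | no ¬fs = evict-settled place s ¬fs , feasible-2k (evict p q k init comp s place) s (proj₂ (evict-spec s place))

  settles-spec : ∀ ss place → Settled place (foldl (settle₁ p q k init comp) place ss) × All (Feasible (foldl (settle₁ p q k init comp) place ss)) ss
  settles-spec [] place = settled-refl place , []
  settles-spec (s ∷ ss) place with settle₁-spec place s | settles-spec ss (settle₁ p q k init comp place s)
  ... | s₁ , f | s₂ , fs = settled-trans s₁ s₂ , Settled.keep s₂ s f ∷ fs

  settle-spec : ∀ place → Settled place (settle p q k init comp place) × (∀ s → Feasible (settle p q k init comp place) s)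
  settle-spec place = proj₁ (settles-spec (allFin ℓ) place) , λ s → All.lookup (proj₂ (settles-spec (allFin ℓ) place)) (∈-allFin s)

-- Amortised analysis

connected-trans : ∀ {n} {E : List (Edge n)} {u v w} → Connected E u v → Connected E v w → Connected E u w
connected-trans here      vw = vw
connected-trans (fwd e c) vw = fwd e (connected-trans c vw)
connected-trans (bwd e c) vw = bwd e (connected-trans c vw)

connected-sym : ∀ {n} {E : List (Edge n)} {u v} → Connected E u v → Connected E v u
connected-sym here      = here
connected-sym (fwd e c) = connected-trans (connected-sym c) (bwd e here)
connected-sym (bwd e c) = connected-trans (connected-sym c) (fwd e here)

connected-⊆ : ∀ {n} {E E′ : List (Edge n)} {u v} → (∀ {e} → e ∈ E → e ∈ E′) → Connected E u v → Connected E′ u v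
connected-⊆ sub here      = here
connected-⊆ sub (fwd e c) = fwd (sub e) (connected-⊆ sub c)
connected-⊆ sub (bwd e c) = bwd (sub e) (connected-⊆ sub c)

-- `OfflineFeasible` constrains only positive times; for the empty sequence the graph has no edges
-- and the condition is trivial.
offline-cc : ∀ {n ℓ k} {init : Assignment n ℓ} σ {b} → OfflineFeasible k init σ b → CC (take (length σ) σ) (b (length σ))
offline-cc []      _         = λ { u .u here → refl ; u v (fwd () _) ; u v (bwd () _) }
offline-cc (e ∷ σ) (_ , off) = proj₁ (off (length (e ∷ σ)) (s≤s z≤n) ≤-refl)

sumTo-cong : ∀ {f g : ℕ → ℕ} → (∀ t → f t ≡ g t) → ∀ T → sumTo T f ≡ sumTo T g
sumTo-cong eq zero    = refl
sumTo-cong eq (suc T) = cong₂ _+_ (sumTo-cong eq T) (eq T)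

module Analysis {n ℓ} (p q k : ℕ) (init : Assignment n ℓ)
  (q<p : q < p) (n≤ℓk : n ≤ ℓ * k) (balanced : Balanced k init) where

  spread : State n ℓ → ℕ
  spread S = sum (λ c → excess init (comp S) (place S c) c)

  -- An eviction costs at most 1 + q times the overflow it removes. Any other move may add one unit
  -- of overflow per vertex, so its price is 2 + q per vertex. A return of z vertices frees at least
  -- z/2 of `spread`, hence the weight 2(2 + q). A merge move of x raises `spread` by at most the
  -- size of x, which brings its price to 3(2 + q), the factor of `budget` in `Paid`.
  potential : State n ℓ → ℕ
  potential S = (1 + q) * overflow (2 * k) (assignment S) + 2 * (2 + q) * spread S

  budget : State n ℓ → ℕ
  budget S = sum (credit init (comp S))

  -- The amortised inequality with all differences cleared: cost plus rise of potential is at most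
  -- 3(2 + q) times the rise of the budget.
  Paid : State n ℓ → State n ℓ → Set
  Paid S S′ = moves (assignment S) (assignment S′) + potential S′ + 3 * (2 + q) * budget S
                ≤ potential S + 3 * (2 + q) * budget S′

  paid-refl : ∀ S → Paid S S
  paid-refl S = ≤-reflexive (cong (λ m → m + potential S + 3 * (2 + q) * budget S) (moves-refl (assignment S)))

  paid-trans : ∀ {S T U} → Paid S T → Paid T U → Paid S U
  paid-trans {S} {T} {U} st tu = ≤-from 0
    (+-mono-≤ (moves-triangle (assignment S) (assignment T) (assignment U)) (+-mono-≤ st tu))
    (eq (moves (assignment S) (assignment U)) (moves (assignment S) (assignment T)) (moves (assignment T) (assignment U))
      (potential S) (potential T) (potential U)
      (3 * (2 + q) * budget S) (3 * (2 + q) * budget T) (3 * (2 + q) * budget U))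
    where
    eq : ∀ m m₁ m₂ ps pt pu bs bt bu →
      m + pu + bs + (m₁ + m₂ + (ps + bt + (pt + bu))) + 0 ≡ ps + bu + (m + (m₁ + pt + bs + (m₂ + pu + bt)))
    eq = solve-∀

  -- No other server is the origin of more than 3/4 of `c`. This invariant provides the foreign
  -- quarter needed by `credit-merge-apart`.
  Anchored : State n ℓ → Fin n → Set
  Anchored S c = ∀ r → r ≢ place S c → size (comp S) c ≤ 4 * others init (comp S) r c

  -- Merging two components

  module Merge (S : State n ℓ) {x y : Fin n} (x≢y : x ≢ y)
    (x≤y : size (comp S) x ≤ size (comp S) y) (1≤x : 1 ≤ size (comp S) x) (anchored : ∀ c → Anchored S c) where

    merged : State n ℓ
    merged = ⟨ relabel (comp S) x y , place S ⟩

    private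
      κ = comp S
      κ′ = comp merged
      π = place S

      size-target : size κ′ y ≡ size κ x + size κ y
      size-target = mass-relabel-target κ x≢y (λ _ → 1)

      size-source : size κ′ x ≡ 0
      size-source = mass-relabel-source κ x≢y (λ _ → 1)

      size-off : ∀ {c} → c ≢ x → c ≢ y → size κ′ c ≡ size κ c
      size-off = mass-relabel-off κ x≢y (λ _ → 1)

      others-target : ∀ r → others init κ′ r y ≡ others init κ r x + others init κ r y
      others-target r = mass-relabel-target κ x≢y (λ v → [ ¬? (init v ≟ r) ]ᵢ)

      others-off : ∀ r {c} → c ≢ x → c ≢ y → others init κ′ r c ≡ others init κ r c
      others-off r = mass-relabel-off κ x≢y (λ v → [ ¬? (init v ≟ r) ]ᵢ)

      excess-off : ∀ c → c ≢ x → c ≢ y → excess init κ′ (π c) c ≤ excess init κ (π c) c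
      excess-off c c≢x c≢y = excess-≤ init κ′ (π c) c (λ r r≢ → begin
        size κ′ c                                        ≡⟨ size-off c≢x c≢y ⟩
        size κ c                                         ≤⟨ size-≤-excess init κ c r≢ ⟩
        2 * others init κ r c + excess init κ (π c) c    ≡⟨ cong (λ o → 2 * o + excess init κ (π c) c) (others-off r c≢x c≢y) ⟨
        2 * others init κ′ r c + excess init κ (π c) c   ∎)
        where open ≤-Reasoning

      excess-source : excess init κ′ (π x) x ≡ 0
      excess-source = n≤0⇒n≡0 (excess-≤ init κ′ (π x) x (λ r _ → ≤-trans (≤-reflexive size-source) z≤n))

      excess-target : ∀ {b} → (∀ r → r ≢ π y → size κ x + size κ y ≤ 2 * (others init κ r x + others init κ r y) + b) →
        excess init κ′ (π y) y ≤ b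
      excess-target {b} le = excess-≤ init κ′ (π y) y (λ r r≢ → begin
        size κ′ y                                             ≡⟨ size-target ⟩
        size κ x + size κ y                                   ≤⟨ le r r≢ ⟩
        2 * (others init κ r x + others init κ r y) + b       ≡⟨ cong (λ o → 2 * o + b) (others-target r) ⟨
        2 * others init κ′ r y + b                            ∎)
        where open ≤-Reasoning

      spread-merge : ∀ e → excess init κ′ (π y) y ≤ excess init κ (π x) x + excess init κ (π y) y + e →
        spread merged + 0 ≤ spread S + e
      spread-merge e le = sum-≤-at₂ (λ c → excess init κ′ (π c) c) (λ c → excess init κ (π c) c) x y 0 e x≢y excess-off
        (≤-trans (≤-reflexive (trans (+-identityʳ _) (cong (_+ excess init κ′ (π y) y) excess-source))) le)

      budget-merge : ∀ e → credit init κ x + credit init κ y + e ≤ credit init κ′ y →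
        budget S + e ≤ budget merged + 0
      budget-merge e le = sum-≤-at₂ (credit init κ) (credit init κ′) x y e 0 x≢y (credit-off init κ x≢y x≤y)
        (≤-trans le (≤-reflexive (trans (cong (_+ credit init κ′ y) (sym (credit-source init κ x≢y x≤y))) (sym (+-identityʳ _)))))

      pay : ∀ e → moves (assignment S) (assignment merged) ≤ e →
        spread merged + 0 ≤ spread S + e → budget S + e ≤ budget merged + 0 → Paid S merged
      pay e m≤ x≤ b≤ = ≤-from 0
        (+-mono-≤ (+-mono-≤ (*-monoʳ-≤ (2 + q) m≤) (*-monoʳ-≤ (1 + q) (overflow-moves (2 * k) (assignment S) (assignment merged))))
                  (+-mono-≤ (*-monoʳ-≤ (2 * (2 + q)) x≤) (*-monoʳ-≤ (3 * (2 + q)) b≤)))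
        (eq q (moves (assignment S) (assignment merged)) e
            (overflow (2 * k) (assignment S)) (overflow (2 * k) (assignment merged))
            (spread S) (spread merged) (budget S) (budget merged))
        where
        eq : ∀ q m e o o′ x x′ b b′ →
          m + ((1 + q) * o′ + 2 * (2 + q) * x′) + 3 * (2 + q) * b
            + ((2 + q) * e + (1 + q) * (o + m) + (2 * (2 + q) * (x + e) + 3 * (2 + q) * (b′ + 0))) + 0
          ≡ (1 + q) * o + 2 * (2 + q) * x + 3 * (2 + q) * b′
            + ((2 + q) * m + (1 + q) * o′ + (2 * (2 + q) * (x′ + 0) + 3 * (2 + q) * (b + e)))
        eq = solve-∀

    merge-paid : Paid S merged
    merge-paid with π x ≟ π y
    -- On a common server nothing moves, and for each other `r` the two size bounds add up, so the
    -- excess is subadditive.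
    ... | yes together = pay 0
      (≤-reflexive (moves-relabel-together κ π x y together))
      (spread-merge 0 (excess-target (λ r r≢ → ≤-from 0
        (+-mono-≤ (size-≤-excess init κ x (λ eq → r≢ (trans eq together))) (size-≤-excess init κ y r≢))
        (arith (size κ x) (size κ y) (others init κ r x) (others init κ r y) (excess init κ (π x) x) (excess init κ (π y) y)))))
      (budget-merge 0 (credit-merge-together init κ x≢y x≤y))
      where
      arith : ∀ sx sy ox oy ex ey →
        sx + sy + (2 * ox + ex + (2 * oy + ey)) + 0 ≡ 2 * (ox + oy) + (ex + ey + 0) + (sx + sy)
      arith = solve-∀
    -- The excess bound of x refers to its old server and is dropped; x enters the excess of the
    -- union with its full size.
    ... | no apart = pay (size κ x)
      (moves-relabel κ π x y)
      (spread-merge (size κ x) (excess-target (λ r r≢ → ≤-from (2 * others init κ r x + excess init κ (π x) x)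
        (size-≤-excess init κ y r≢)
        (arith (size κ x) (size κ y) (others init κ r x) (others init κ r y) (excess init κ (π x) x) (excess init κ (π y) y)))))
      (budget-merge (size κ x) (credit-merge-apart init κ x≢y x≤y 1≤x foreign))
      where
      arith : ∀ sx sy ox oy ex ey →
        sx + sy + (2 * oy + ey) + (2 * ox + ex) ≡ 2 * (ox + oy) + (ex + ey + sx) + sy
      arith = solve-∀
      -- As x and y lie on different servers, `r` differs from the server of one of them, and
      -- anchoring applies to that one.
      foreign : ∀ r → size κ x ≤ 4 * others init κ r x ⊎ size κ y ≤ 4 * others init κ r y
      foreign r with r ≟ π x
      ... | no r≢    = inj₁ (anchored x r r≢)
      ... | yes refl = inj₂ (anchored y r apart)

    merge-anchored : ∀ c → c ≢ y → Anchored merged c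
    merge-anchored c c≢y r r≢ with c ≟ x
    ... | yes refl = ≤-trans (≤-reflexive size-source) z≤n
    ... | no c≢x   = begin
      size κ′ c                ≡⟨ size-off c≢x c≢y ⟩
      size κ c                 ≤⟨ anchored c r r≢ ⟩
      4 * others init κ r c    ≡⟨ cong (4 *_) (others-off r c≢x c≢y) ⟨
      4 * others init κ′ r c   ∎
      where open ≤-Reasoning

  -- Return to the majority origin, and eviction on states

  rehomed : Fin n → State n ℓ → State n ℓ
  rehomed y S = ⟨ comp S , rehome p q k init (comp S) y (place S) ⟩

  -- The return wipes out the excess of `y`, which is worth at least half its size because the
  -- threshold is 3/4 and not 1/2. At the new server `h` the component is anchored again.
  rehome-spec : ∀ S y → (∀ c → c ≢ y → Anchored S c) → Paid S (rehomed y S) × (∀ c → Anchored (rehomed y S) c)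
  rehome-spec S y anchored
    with any? (λ r → ¬? (r ≟ place S y) ×-dec (4 * others init (comp S) r y <? size (comp S) y))
  ... | no ¬p = paid-refl S , anchored′
    where
    anchored′ : ∀ c → Anchored S c
    anchored′ c with c ≟ y
    ... | no c≢y   = anchored c c≢y
    ... | yes refl = λ r r≢ → ≮⇒≥ (λ lt → ¬p (r , r≢ , lt))
  ... | yes (h , h≢ , lt) = paid , anchored′
    where
    κ = comp S
    π = place S
    π′ = relocate π y h
    S′ = ⟨ κ , π′ ⟩
    z = size κ y
    ε = excess init κ (π y) y

    -- Fewer than a quarter of the vertices are foreign to `h`, so by `others-cover` more than three
    -- quarters are foreign to `r`; half is enough.
    far : ∀ {r} → r ≢ h → z ≤ 2 * others init κ r y
    far {r} r≢h = *-cancelˡ-≤ 2 (≤-from z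
      (+-mono-≤ (*-monoʳ-≤ 4 (others-cover init κ y r≢h)) (<⇒≤ lt))
      (arith z (others init κ h y) (others init κ r y)))
      where
      arith : ∀ z o o′ → 2 * z + (4 * (o′ + o) + z) + z ≡ 2 * (2 * o′) + (4 * z + 4 * o)
      arith = solve-∀

    z≤2ε : z ≤ 2 * ε
    z≤2ε = ≤-from 0 (+-mono-≤ (*-monoʳ-≤ 2 (size-≤-excess init κ y h≢)) (<⇒≤ lt)) (arith z (others init κ h y) ε)
      where
      arith : ∀ z o e → z + (2 * (2 * o + e) + z) + 0 ≡ 2 * e + (2 * z + 4 * o)
      arith = solve-∀

    excess-home : excess init κ (π′ y) y ≡ 0
    excess-home = n≤0⇒n≡0 (excess-≤ init κ (π′ y) y (λ r r≢ →
      ≤-trans (far (λ eq → r≢ (trans eq (sym (relocate-at π y h))))) (m≤m+n _ 0)))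

    spread≤ : spread S′ + ε ≤ spread S + 0
    spread≤ = sum-≤-at₁ (λ c → excess init κ (π′ c) c) (λ c → excess init κ (π c) c) y ε 0
      (λ c c≢y → ≤-reflexive (cong (λ s → excess init κ s c) (relocate-off π y h c≢y)))
      (≤-reflexive (trans (cong (_+ ε) excess-home) (sym (+-identityʳ ε))))

    paid : Paid S S′
    paid = ≤-from 0
      (+-mono-≤ (+-mono-≤ (*-monoʳ-≤ (2 + q) (moves-relocate κ π y h)) (*-monoʳ-≤ (1 + q) (overflow-moves (2 * k) (assignment S) (assignment S′))))
                (+-mono-≤ (*-monoʳ-≤ (2 * (2 + q)) spread≤) (*-monoʳ-≤ (2 + q) z≤2ε)))
      (arith q (moves (assignment S) (assignment S′)) z ε
        (overflow (2 * k) (assignment S)) (overflow (2 * k) (assignment S′)) (spread S) (spread S′) (budget S))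
      where
      arith : ∀ q m z e o o′ x x′ b →
        m + ((1 + q) * o′ + 2 * (2 + q) * x′) + 3 * (2 + q) * b
          + ((2 + q) * z + (1 + q) * (o + m) + (2 * (2 + q) * (x + 0) + (2 + q) * (2 * e))) + 0
        ≡ (1 + q) * o + 2 * (2 + q) * x + 3 * (2 + q) * b
          + ((2 + q) * m + (1 + q) * o′ + (2 * (2 + q) * (x′ + e) + (2 + q) * z))
      arith = solve-∀

    anchored′ : ∀ c → Anchored S′ c
    anchored′ c r r≢ with c ≟ y
    ... | no c≢y   = anchored c c≢y r r≢
    ... | yes refl = ≤-trans (far r≢) (*-monoˡ-≤ (others init κ r y) {2} {4} (s≤s (s≤s z≤n)))

  settled : State n ℓ → State n ℓ
  settled S = ⟨ comp S , settle p q k init (comp S) (place S) ⟩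

  -- By `Quiet`, each server that becomes foreign to a component is the origin of at most half of
  -- it. Anchoring survives and no excess grows, so the overflow alone pays.
  settle-state-spec : ∀ S → (∀ c → size (comp S) c ≤ k) → (∀ c → Anchored S c) →
    Paid S (settled S) × (∀ c → Anchored (settled S) c) × LoadAtMostAug p q k (assignment (settled S))
  settle-state-spec S small anchored = paid , anchored′ , proj₂ spec
    where
    open Eviction p q k init (comp S) q<p n≤ℓk balanced small
    S′ = settled S
    spec = settle-spec (place S)

    anchored′ : ∀ c → Anchored S′ c
    anchored′ c r r≢ with Settled.quiet (proj₁ spec) c r r≢
    ... | inj₁ r≢′ = anchored c r r≢′
    ... | inj₂ le  = ≤-trans le (*-monoˡ-≤ (others init (comp S) r c) {2} {4} (s≤s (s≤s z≤n)))

    excess≤ : ∀ c → excess init (comp S) (place S′ c) c ≤ excess init (comp S) (place S c) c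
    excess≤ c = excess-≤ init (comp S) (place S′ c) c bound
      where
      bound : ∀ r → r ≢ place S′ c → size (comp S) c ≤ 2 * others init (comp S) r c + excess init (comp S) (place S c) c
      bound r r≢ with Settled.quiet (proj₁ spec) c r r≢
      ... | inj₁ r≢′ = size-≤-excess init (comp S) c r≢′
      ... | inj₂ le  = ≤-trans le (m≤m+n _ _)

    paid : Paid S S′
    paid = ≤-from 0
      (+-mono-≤ (Settled.cost (proj₁ spec)) (*-monoʳ-≤ (2 * (2 + q)) (sum-mono excess≤)))
      (arith (moves (assignment S) (assignment S′)) ((1 + q) * overflow (2 * k) (assignment S))
        ((1 + q) * overflow (2 * k) (assignment S′)) (2 * (2 + q) * spread S) (2 * (2 + q) * spread S′) (3 * (2 + q) * budget S))
      where
      arith : ∀ m o o′ x x′ b → m + (o′ + x′) + b + (o + x) + 0 ≡ o + x + b + (m + o′ + x′)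
      arith = solve-∀

  -- Invariant of a run

  record Invariant (E : List (Edge n)) (S : State n ℓ) : Set where
    field
      -- Together with `edges` this makes the labels describe the connected components exactly:
      -- `edges` gives the cc-condition, `joined` the comparison with other assignments.
      joined   : ∀ v → Connected E v (comp S v)
      edges    : ∀ {u v} → (u , v) ∈ E → comp S u ≡ comp S v
      anchored : ∀ c → Anchored S c
      feasible : LoadAtMostAug p q k (assignment S)

    comp-connected : ∀ {u v} → Connected E u v → comp S u ≡ comp S v
    comp-connected here      = refl
    comp-connected (fwd e c) = trans (edges e) (comp-connected c)
    comp-connected (bwd e c) = trans (sym (edges e)) (comp-connected c)

  -- A feasible assignment keeps the component on one server, whose load bounds the size. The
  -- assignment comes from the promise on the request sequence.
  component-≤-load : ∀ {E} (κ : Fin n → Fin n) → (∀ v → Connected E v (κ v)) →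
    (b : Assignment n ℓ) → CC E b → LoadAtMost k b → ∀ c → size κ c ≤ k
  component-≤-load κ joined b cc fits c =
    ≤-trans (≤-trans (sum-mono pointwise) (≤-reflexive (sym (load-sum b (b c))))) (fits (b c))
    where
    pointwise : ∀ v → [ κ v ≟ c ]ᵢ * 1 ≤ [ b v ≟ b c ]ᵢ
    pointwise v with κ v ≟ c
    ... | no _ = z≤n
    ... | yes refl with b v ≟ b (κ v)
    ...   | yes _ = ≤-refl
    ...   | no ne = ⊥-elim (ne (cc v (κ v) (joined v)))

  relabel-source : ∀ (κ : Fin n → Fin n) x y {v} → κ v ≡ x → relabel κ x y v ≡ y
  relabel-source κ x y {v} eq with κ v ≟ x
  ... | yes _ = refl
  ... | no ne = ⊥-elim (ne eq)

  relabel-target : ∀ (κ : Fin n → Fin n) x y {v} → κ v ≡ y → relabel κ x y v ≡ y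
  relabel-target κ x y {v} eq with κ v ≟ x
  ... | yes _ = refl
  ... | no _  = eq

  relabel-cong : ∀ (κ : Fin n → Fin n) x y {u v} → κ u ≡ κ v → relabel κ x y u ≡ relabel κ x y v
  relabel-cong κ x y eq = cong (λ c → if does (c ≟ x) then y else c) eq

  module _ {E : List (Edge n)} {e : Edge n} (b : Assignment n ℓ) (cc : CC (E ∷ʳ e) b) (fits : LoadAtMost k b) where

    private
      old : ∀ {f} → f ∈ E → f ∈ E ∷ʳ e
      old = ∈-++⁺ˡ

      new : e ∈ E ∷ʳ e
      new = ∈-++⁺ʳ E (Any.here refl)

      edges-∷ʳ : ∀ (κ : Fin n → Fin n) → (∀ {u v} → (u , v) ∈ E → κ u ≡ κ v) → κ (proj₁ e) ≡ κ (proj₂ e) →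
        ∀ {u v} → (u , v) ∈ E ∷ʳ e → κ u ≡ κ v
      edges-∷ʳ κ es eq uv with ∈-++⁻ E uv
      ... | inj₁ m                = es m
      ... | inj₂ (Any.here refl)  = eq

    absorb-spec : ∀ {S x y} → Invariant E S → x ≢ y → size (comp S) x ≤ size (comp S) y → 1 ≤ size (comp S) x →
      Connected (E ∷ʳ e) x y → relabel (comp S) x y (proj₁ e) ≡ relabel (comp S) x y (proj₂ e) →
      Invariant (E ∷ʳ e) (absorb p q k init x y S) × Paid S (absorb p q k init x y S)
    absorb-spec {S} {x} {y} inv x≢y x≤y 1≤x xy ends = record
      { joined   = joined′
      ; edges    = edges-∷ʳ κ′ (λ m → relabel-cong (comp S) x y (Invariant.edges inv m)) ends
      ; anchored = proj₁ (proj₂ settle-ok)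
      ; feasible = proj₂ (proj₂ settle-ok)
      } , paid-trans {S} {S₁} {S₃} merge-paid (paid-trans {S₁} {S₂} {S₃} (proj₁ rehome-ok) (proj₁ settle-ok))
      where
      open Merge S x≢y x≤y 1≤x (Invariant.anchored inv)
      κ′ = relabel (comp S) x y
      S₁ = merged
      S₂ = rehomed y S₁
      S₃ = settled S₂
      joined′ : ∀ v → Connected (E ∷ʳ e) v (κ′ v)
      joined′ v with comp S v ≟ x | connected-⊆ old (Invariant.joined inv v)
      ... | yes refl | vx = connected-trans vx xy
      ... | no _     | vc = vc
      rehome-ok = rehome-spec S₁ y merge-anchored
      settle-ok = settle-state-spec S₂ (component-≤-load κ′ joined′ b cc fits) (proj₂ rehome-ok)

    step-spec : ∀ {S} → Invariant E S → Invariant (E ∷ʳ e) (step p q k init S e) × Paid S (step p q k init S e)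
    step-spec {S} inv with comp S (proj₁ e) ≟ comp S (proj₂ e)
    ... | yes eq = record
      { joined   = λ v → connected-⊆ old (Invariant.joined inv v)
      ; edges    = edges-∷ʳ (comp S) (Invariant.edges inv) eq
      ; anchored = Invariant.anchored inv
      ; feasible = Invariant.feasible inv
      } , paid-refl S
    ... | no ne with size (comp S) (comp S (proj₁ e)) ≤? size (comp S) (comp S (proj₂ e))
    ...   | yes le = absorb-spec inv ne le (size-inhabited (comp S) (proj₁ e)) bridge
              (trans (relabel-source (comp S) _ _ refl) (sym (relabel-target (comp S) _ _ refl)))
      where
      bridge : Connected (E ∷ʳ e) (comp S (proj₁ e)) (comp S (proj₂ e))
      bridge = connected-trans (connected-sym (connected-⊆ old (Invariant.joined inv (proj₁ e))))
        (fwd new (connected-⊆ old (Invariant.joined inv (proj₂ e))))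
    ...   | no ≰ = absorb-spec inv (ne ∘ sym) (≰⇒≥ ≰) (size-inhabited (comp S) (proj₂ e)) bridge
              (trans (relabel-target (comp S) _ _ refl) (sym (relabel-source (comp S) _ _ refl)))
      where
      bridge : Connected (E ∷ʳ e) (comp S (proj₂ e)) (comp S (proj₁ e))
      bridge = connected-trans (connected-sym (connected-⊆ old (Invariant.joined inv (proj₂ e))))
        (bwd new (connected-⊆ old (Invariant.joined inv (proj₁ e))))

  start-far : ∀ c r → r ≢ init c → size id c ≤ others init id r c
  start-far c r r≢ = mass-mono id c pointwise
    where
    pointwise : ∀ v → v ≡ c → 1 ≤ [ ¬? (init v ≟ r) ]ᵢ
    pointwise v refl with init v ≟ r
    ... | yes eq = ⊥-elim (r≢ (sym eq))
    ... | no _   = ≤-refl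

  start-invariant : Invariant [] (start p q k init)
  start-invariant = record
    { joined   = λ _ → here
    ; edges    = λ ()
    ; anchored = λ c r r≢ → ≤-trans (start-far c r r≢) (m≤m+n _ _)
    ; feasible = λ s → ≤-trans (≤-reflexive (cong (q *_) (balanced s))) (*-monoˡ-≤ k (m≤m+n q p))
    }

  -- Starting from potential zero makes the ratio strict, without an additive term.
  start-potential : potential (start p q k init) ≡ 0
  start-potential = trans (cong₂ (λ o x → (1 + q) * o + 2 * (2 + q) * x) no-overflow no-spread)
    (cong₂ _+_ (*-zeroʳ (1 + q)) (*-zeroʳ (2 * (2 + q))))
    where
    no-overflow : overflow (2 * k) init ≡ 0
    no-overflow = trans (sum-cong-≗ (λ s → m≤n⇒m∸n≡0 (≤-trans (≤-reflexive (balanced s)) (m≤m+n k _)))) (sum-zero ℓ)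
    no-spread : spread (start p q k init) ≡ 0
    no-spread = trans (sum-cong-≗ (λ c → n≤0⇒n≡0 (excess-≤ init id (init c) c
      (λ r r≢ → ≤-trans (start-far c r r≢) (≤-trans (m≤m+n _ _) (m≤m+n _ 0)))))) (sum-zero n)

  -- This is the only use of the offline solution: it must keep every component on one server.
  budget-≤ : ∀ {E S} → Invariant E S → (∀ c → size (comp S) c ≤ k) → (b : Assignment n ℓ) → CC E b →
    budget S ≤ 8 * (1 + ⌊log₂ k ⌋) * moves init b
  budget-≤ {E} {S} inv small b cc = begin
    budget S                                                       ≤⟨ sum-mono component ⟩
    sum (λ c → 8 * (1 + ⌊log₂ k ⌋) * mass (comp S) displaced c)    ≡⟨ *-distribˡ-sum (8 * (1 + ⌊log₂ k ⌋)) (mass (comp S) displaced) ⟨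
    8 * (1 + ⌊log₂ k ⌋) * sum (mass (comp S) displaced)            ≡⟨ cong (8 * (1 + ⌊log₂ k ⌋) *_) (trans (sum-mass (comp S) displaced) (sym (moves-sum init b))) ⟩
    8 * (1 + ⌊log₂ k ⌋) * moves init b                             ∎
    where
    open ≤-Reasoning
    displaced : Fin n → ℕ
    displaced v = [ ¬? (init v ≟ b v) ]ᵢ
    arith : ∀ o l → 8 * o * l ≡ 8 * l * o
    arith = solve-∀
    -- In `b` the whole component lies on the server of its label, so every vertex not starting
    -- there is displaced.
    offline : ∀ c → others init (comp S) (b c) c ≤ mass (comp S) displaced c
    offline c = mass-mono (comp S) c λ { v refl →
      ≤-reflexive (cong (λ s → [ ¬? (init v ≟ s) ]ᵢ) (sym (cc v (comp S v) (Invariant.joined inv v)))) }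
    component : ∀ c → credit init (comp S) c ≤ 8 * (1 + ⌊log₂ k ⌋) * mass (comp S) displaced c
    component c = begin
      credit init (comp S) c
        ≤⟨ *-mono-≤ (charge-≤-others init (comp S) c (b c)) (s≤s (⌊log₂⌋-mono-≤ (small c))) ⟩
      8 * others init (comp S) (b c) c * (1 + ⌊log₂ k ⌋)
        ≤⟨ *-monoˡ-≤ (1 + ⌊log₂ k ⌋) (*-monoʳ-≤ 8 (offline c)) ⟩
      8 * mass (comp S) displaced c * (1 + ⌊log₂ k ⌋)
        ≡⟨ arith (mass (comp S) displaced c) (1 + ⌊log₂ k ⌋) ⟩
      8 * (1 + ⌊log₂ k ⌋) * mass (comp S) displaced c ∎

  -- Whole request sequences and the competitive ratio

  module _ (σ : List (Edge n)) (valid : ValidSeq ℓ k σ) where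

    state : ℕ → State n ℓ
    state t = foldl (step p q k init) (start p q k init) (take t σ)

    -- `Paid` telescopes along the run; validity of each prefix provides the size bound for the next
    -- step.
    trajectory : ∀ t → t ≤ length σ → Invariant (take t σ) (state t) ×
      scheduleMoves (assignment ∘ state) t + potential (state t) ≤ 3 * (2 + q) * budget (state t)
    trajectory zero _ = start-invariant , ≤-trans (≤-reflexive start-potential) z≤n
    trajectory (suc t) t<len with trajectory t (<⇒≤ t<len) | valid (suc t) t<len | take-suc σ (fromℕ< t<len)
    -- The rewrites expose the last edge of the prefix, so that the fold becomes one `step` from the
    -- previous state.
    ... | inv , cost | b , cc , fits | eq rewrite toℕ-fromℕ< t<len | eq
      | foldl-∷ʳ (step p q k init) (start p q k init) (lookup σ (fromℕ< t<len)) (take t σ) =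
      proj₁ next , ≤-from 0 (+-mono-≤ cost (proj₂ next))
        (arith (scheduleMoves (assignment ∘ state) t) (moves (assignment (state t)) (assignment S′))
          (potential (state t)) (potential S′) (3 * (2 + q) * budget (state t)) (3 * (2 + q) * budget S′))
      where
      S′ = step p q k init (state t) (lookup σ (fromℕ< t<len))
      next = step-spec b cc fits inv
      arith : ∀ c m p p′ b b′ → c + m + p′ + (b + (p + b′)) + 0 ≡ b′ + (c + p + (m + p′ + b))
      arith = solve-∀

    -- The constant 24 is the price 3 of a unit of budget times the factor 8 in `charge`.
    total-≤ : (b : Assignment n ℓ) → CC (take (length σ) σ) b →
      scheduleMoves (assignment ∘ state) (length σ) ≤ 24 * (2 + q) * (1 + ⌊log₂ k ⌋) * moves init b
    total-≤ b cc with trajectory (length σ) ≤-refl | valid (length σ) ≤-refl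
    ... | inv , cost | b′ , cc′ , fits = begin
      scheduleMoves (assignment ∘ state) (length σ)               ≤⟨ m≤m+n _ _ ⟩
      scheduleMoves (assignment ∘ state) (length σ) + potential S ≤⟨ cost ⟩
      3 * (2 + q) * budget S                                      ≤⟨ *-monoʳ-≤ (3 * (2 + q)) (budget-≤ inv small b cc) ⟩
      3 * (2 + q) * (8 * (1 + ⌊log₂ k ⌋) * moves init b)          ≡⟨ arith q (1 + ⌊log₂ k ⌋) (moves init b) ⟩
      24 * (2 + q) * (1 + ⌊log₂ k ⌋) * moves init b               ∎
      where
      open ≤-Reasoning
      S = state (length σ)
      small = component-≤-load (comp S) (Invariant.joined inv) b′ cc′ fits
      arith : ∀ q l m → 3 * (2 + q) * (8 * l * m) ≡ 24 * (2 + q) * l * m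
      arith = solve-∀

    competitive : ∀ b → OfflineFeasible k init σ b →
      scheduleMoves (assignment ∘ state) (length σ) ≤ 24 * (2 + q) * (1 + ⌊log₂ k ⌋) * scheduleMoves b (length σ)
    competitive b off@(b₀≡init , _) = ≤-trans (total-≤ (b (length σ)) (offline-cc σ off))
      (*-monoʳ-≤ (24 * (2 + q) * (1 + ⌊log₂ k ⌋))
        (subst (λ a → moves a (b (length σ)) ≤ scheduleMoves b (length σ)) b₀≡init (moves-schedule b (length σ))))

-- An `OnlineAlg` has no memory besides its arguments, so the internal state is recomputed from the
-- revealed prefix.
algorithm : ∀ {n ℓ} → ℕ → ℕ → ℕ → OnlineAlg n ℓ
algorithm p q k init es = assignment (foldl (step p q k init) (start p q k init) es)

theorem5p2 : (p q : ℕ) → 0 < q → q < p →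
    Σ ℕ (λ C → (ℓ k : ℕ) → Σ (OnlineAlg (ℓ * k) ℓ) (λ A →
    (init : Assignment (ℓ * k) ℓ) → Balanced k init →
    (σ : _) → ValidSeq ℓ k σ →
    OnlineFeasible p q k (run A init σ) σ
    × ((b : _) → OfflineFeasible k init σ b →
    scheduleMoves (run A init σ) (length σ)
    ≤ C * (1 + ⌊log₂ k ⌋) * scheduleMoves b (length σ))))
-- The constant grows with q because q < p guarantees a margin ε - 1 of only 1/q.
theorem5p2 p q _ q<p = 24 * (2 + q) , λ ℓ k → algorithm p q k , guarantee ℓ k
  where
  guarantee : ∀ ℓ k (init : Assignment (ℓ * k) ℓ) → Balanced k init → ∀ σ → ValidSeq ℓ k σ →
    OnlineFeasible p q k (run (algorithm p q k) init σ) σ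
    × (∀ b → OfflineFeasible k init σ b →
        scheduleMoves (run (algorithm p q k) init σ) (length σ)
          ≤ 24 * (2 + q) * (1 + ⌊log₂ k ⌋) * scheduleMoves b (length σ))
  guarantee ℓ k init balanced σ valid = online , λ b off →
    ≤-trans (≤-reflexive (sumTo-cong (λ t → cong₂ moves (run≡ t) (run≡ (suc t))) (length σ))) (competitive σ valid b off)
    where
    open Analysis p q k init q<p ≤-refl balanced
    run≡ : ∀ t → run (algorithm p q k) init σ t ≡ assignment (state σ valid t)
    run≡ zero    = refl
    run≡ (suc t) = refl
    online : OnlineFeasible p q k (run (algorithm p q k) init σ) σ
    online (suc t) _ t≤ = (λ u v uv → cong (place (state σ valid (suc t))) (Invariant.comp-connected inv uv)) , Invariant.feasible inv
      where inv = proj₁ (trajectory σ valid (suc t) t≤)
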